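{- Let $m=m(n)$ and $k=k(n)$ be integer functions of $n$ satisfying $4\le m\le\min\{k,n/2\}$ and $k\le n$. Then $\mathbb{E}_m(k,n)=O(n^{ -2})$ as $n\to\infty$.
   Context: A $k\times n$ Latin rectangle (with $k\le n$ positive integers) is a $k\times n$ matrix on $n$ symbols (the symbol set is $[n]=\{1,\dots,n\}$), each of which occurs at most once in each row and column; so each row is a permutation of $[n]$. If $k=n$ it is a Latin square of order $n$. A subsquare of order $m$ of a Latin rectangle $L$ is an $m\times m$ submatrix of $L$ (induced by a set of $m$ rows and a set of $m$ columns, not necessarily contiguous) which is itself a Latin square, i.e. contains exactly $m$ distinct symbols. For an integer $2\le m\le n/2$, $\mathbb{E}_m(k,n)$ denotes the expected number of subsquares of order $m$ in a uniformly random $k\times n$ Latin rectangle. Asymptotics are as $n\to\infty$, with $k$ a function of $n$. -}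

module Defs where

open import Data.Bool.Base using (true; false)
open import Data.Fin.Base using (Fin; toℕ)
open import Data.Fin.Properties using (any?; all?; _≟_; toℕ<n; toℕ-fromℕ<; toℕ-injective)
open import Data.Fin.Subset using (Subset; _∈_; ∣_∣)
open import Data.Fin.Subset.Properties using (_∈?_)
open import Data.Integer.Base using (+_)
open import Data.List.Base using (List; []; _∷_; [_]; map; length; filter; allFin; cartesianProduct; cartesianProductWith)
open import Data.List.Membership.Propositional using () renaming (_∈_ to _∈ˡ_)
open import Data.List.Membership.Propositional.Properties using (∈-allFin; ∈-filter⁺; ∈-cartesianProductWith⁺)
open import Data.List.Relation.Unary.Any using (here)
open import Data.Nat.ListAction using (sum)
open import Data.Nat.Base using (ℕ; zero; suc; _+_; _∸_; _^_; _≤_; _<_; NonZero)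
import Data.Nat.Properties as ℕ
open import Data.Nat.DivMod using (_%_; _mod_; m<n⇒m%n≡m; %-distribˡ-+; [m+n]%n≡m%n)
open import Data.Product.Base using (_×_; _,_; ∃-syntax)
open import Data.Rational.Base as ℚ using (ℚ; 0ℚ; _/_)
open import Data.Vec.Base using (Vec; []; _∷_; lookup; tabulate)
open import Data.Vec.Properties using (lookup∘tabulate)
open import Relation.Binary.PropositionalEquality using (_≡_; refl; sym; trans; cong; module ≡-Reasoning)
open import Relation.Nullary.Decidable using (Dec; does; _×-dec_; _→-dec_)

private
  variable
    A : Set
    k n : ℕ

-- Symbols are 0, …, n-1 instead of 1, …, n.
Matrix : ℕ → ℕ → Set
Matrix k n = Vec (Vec (Fin n) n) k

entry : Matrix k n → Fin k → Fin n → Fin n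
entry L i j = lookup (lookup L i) j

IsLatin : Matrix k n → Set
IsLatin L = (∀ i j j′ → entry L i j ≡ entry L i j′ → j ≡ j′)
          × (∀ j i i′ → entry L i j ≡ entry L i′ j → i ≡ i′)

isLatin? : (L : Matrix k n) → Dec (IsLatin L)
isLatin? L =
  all? (λ i → all? λ j → all? λ j′ → (entry L i j ≟ entry L i j′) →-dec (j ≟ j′))
  ×-dec
  all? (λ j → all? λ i → all? λ i′ → (entry L i j ≟ entry L i′ j) →-dec (i ≟ i′))

-- Every vector of length n over xs; no repetitions if xs has none.
vectors : List A → (n : ℕ) → List (Vec A n)
vectors xs zero    = [ [] ]
vectors xs (suc n) = cartesianProductWith _∷_ xs (vectors xs n)

matrices : (k n : ℕ) → List (Matrix k n)
matrices k n = vectors (vectors (allFin n) n) k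

latinRectangles : (k n : ℕ) → List (Matrix k n)
latinRectangles k n = filter isLatin? (matrices k n)

subsets : (n : ℕ) → List (Subset n)
subsets = vectors (true ∷ false ∷ [])

symbols : Matrix k n → Subset k → Subset n → Subset n
symbols L R C = tabulate λ s → does
  (any? λ i → any? λ j → (i ∈? R) ×-dec (j ∈? C) ×-dec (entry L i j ≟ s))

-- A submatrix of a Latin rectangle has no repetition in a row or column, so
-- it is a Latin square of order m as soon as it is m × m on m symbols.
IsSubsquare : ℕ → Matrix k n → Subset k × Subset n → Set
IsSubsquare m L (R , C) = ∣ R ∣ ≡ m × ∣ C ∣ ≡ m × ∣ symbols L R C ∣ ≡ m

isSubsquare? : ∀ m (L : Matrix k n) RC → Dec (IsSubsquare m L RC)
isSubsquare? m L (R , C) =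
  (∣ R ∣ ℕ.≟ m) ×-dec (∣ C ∣ ℕ.≟ m) ×-dec (∣ symbols L R C ∣ ℕ.≟ m)

numSubsquares : ℕ → Matrix k n → ℕ
numSubsquares {k} {n} m L =
  length (filter (isSubsquare? m L) (cartesianProduct (subsets k) (subsets n)))

-- Mean of X over a uniformly random element of the list; 0 on the empty list.
expectation : List A → (A → ℕ) → ℚ
expectation []          X = 0ℚ
expectation xs@(_ ∷ _) X = + sum (map X xs) / length xs

-- For k ≤ n the list is non-empty, by latinRectangle-exists below.
𝔼 : (m k n : ℕ) → ℚ
𝔼 m k n = expectation (latinRectangles k n) (numSubsquares m)

-- f = O(g) as n → ∞
_=O_ : (f g : ℕ → ℚ) → Set
f =O g = ∃[ C ] ∃[ N ] ∀ n → N ≤ n → ℚ.∣ f n ∣ ℚ.≤ C ℚ.* ℚ.∣ g n ∣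

infix 4 _=O_

-- The value at 0 is arbitrary.
_⁻² : ℕ → ℚ
zero      ⁻² = 0ℚ
n@(suc _) ⁻² = + 1 / n ^ 2
  where instance _ = ℕ.m^n≢0 n 2

∈-vectors : {xs : List A} → (∀ x → x ∈ˡ xs) → (v : Vec A n) → v ∈ˡ vectors xs n
∈-vectors all∈ []       = here refl
∈-vectors all∈ (x ∷ v) = ∈-cartesianProductWith⁺ _∷_ (all∈ x) (∈-vectors all∈ v)

∈-latinRectangles : (L : Matrix k n) → IsLatin L → L ∈ˡ latinRectangles k n
∈-latinRectangles L = ∈-filter⁺ isLatin? (∈-vectors (∈-vectors ∈-allFin) L)

private
  %-cancel : ∀ a b c n .{{_ : NonZero n}} → a ≤ n → b < n → c < n →
             (a + b) % n ≡ (a + c) % n → b ≡ c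
  %-cancel a b c n a≤n b<n c<n eq = begin
    b                             ≡⟨ recover b b<n ⟨
    (n′ % n + (a + b) % n) % n    ≡⟨ cong (λ x → (n′ % n + x) % n) eq ⟩
    (n′ % n + (a + c) % n) % n    ≡⟨ recover c c<n ⟩
    c                             ∎
    where
    open ≡-Reasoning
    n′ = n ∸ a
    recover : ∀ x → x < n → (n′ % n + (a + x) % n) % n ≡ x
    recover x x<n = begin
      (n′ % n + (a + x) % n) % n  ≡⟨ %-distribˡ-+ n′ (a + x) n ⟨
      (n′ + (a + x)) % n          ≡⟨ cong (_% n) (ℕ.+-assoc n′ a x) ⟨
      (n′ + a + x) % n            ≡⟨ cong (λ y → (y + x) % n) (ℕ.m∸n+n≡m a≤n) ⟩
      (n + x) % n                 ≡⟨ cong (_% n) (ℕ.+-comm n x) ⟩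
      (x + n) % n                 ≡⟨ [m+n]%n≡m%n x n ⟩
      x % n                       ≡⟨ m<n⇒m%n≡m x<n ⟩
      x                           ∎

cyclic : ∀ k n .{{_ : NonZero n}} → Matrix k n
cyclic k n = tabulate λ i → tabulate λ j → (toℕ i + toℕ j) mod n

cyclic-isLatin : ∀ k n .{{_ : NonZero n}} → k ≤ n → IsLatin (cyclic k n)
cyclic-isLatin k n k≤n = rows , columns
  where
  toℕ-entry : ∀ i j → toℕ (entry (cyclic k n) i j) ≡ (toℕ i + toℕ j) % n
  toℕ-entry i j = trans
    (cong toℕ (trans (cong (λ row → lookup row j) (lookup∘tabulate _ i)) (lookup∘tabulate _ j)))
    (toℕ-fromℕ< _)

  i<n : (i : Fin k) → toℕ i < n
  i<n i = ℕ.<-≤-trans (toℕ<n i) k≤n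

  sums : ∀ i j i′ j′ → entry (cyclic k n) i j ≡ entry (cyclic k n) i′ j′ →
         (toℕ i + toℕ j) % n ≡ (toℕ i′ + toℕ j′) % n
  sums i j i′ j′ eq = trans (sym (toℕ-entry i j)) (trans (cong toℕ eq) (toℕ-entry i′ j′))

  rows : ∀ i j j′ → entry (cyclic k n) i j ≡ entry (cyclic k n) i j′ → j ≡ j′
  rows i j j′ eq = toℕ-injective
    (%-cancel (toℕ i) (toℕ j) (toℕ j′) n (ℕ.<⇒≤ (i<n i)) (toℕ<n j) (toℕ<n j′) (sums i j i j′ eq))

  columns : ∀ j i i′ → entry (cyclic k n) i j ≡ entry (cyclic k n) i′ j → i ≡ i′
  columns j i i′ eq = toℕ-injective
    (%-cancel (toℕ j) (toℕ i) (toℕ i′) n (ℕ.<⇒≤ (toℕ<n j)) (i<n i) (i<n i′)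
      (trans (cong (_% n) (ℕ.+-comm (toℕ j) (toℕ i)))
      (trans (sums i j i′ j eq) (cong (_% n) (ℕ.+-comm (toℕ i′) (toℕ j))))))

latinRectangle-exists : ∀ k n .{{_ : NonZero n}} → k ≤ n → ∃[ L ] L ∈ˡ latinRectangles k n
latinRectangle-exists k n k≤n =
  cyclic k n , ∈-latinRectangles (cyclic k n) (cyclic-isLatin k n k≤n)

{-# OPTIONS --safe #-}
-- Pairs of a Latin rectangle L and a subsquare of order m in it, with rows R, columns C and symbols S,
-- are counted by switching.  Let c ∈ C, c′ ∉ C, and exchange the entries of the columns c and c′ on a
-- set of rows closed under "the entry in c equals the entry in c′".  If v ∈ S and V ⊆ S, v ∉ V, one
-- can choose this set such that in column c of the subsquare it hits v but nothing in V, after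
-- exchanging v with a suitable y ∈ V ∪ {v} within the rows R: the closed sets are unions of cycles of a
-- permutation, and exchanging v with the last element of V ∪ {v} on its cycle before v splits off a
-- cycle through v alone.  Since c′ can be read off from the position of v afterwards, each such step
-- gains a factor n − m at the cost of guessing y, and it can be repeated for the elements of V.
--
-- For bounded m the subsquare may be assumed to be cyclic.  Three steps on one column and then, with
-- columns and symbols interchanged, two steps on one symbol gain (n − m)⁵.  Enough of the cyclic
-- square survives to find R, C and S from three of its lines, so there are O(n³) possibilities for
-- the subsquare.
--
-- For 2^(t-1) < m ≤ 2^t with t ≥ 13, there are 2t + 12 steps on one column c.  What survives is a loop
-- without the right multiplication by one of its elements.  Adjoining an element to a proper subloop
-- nearly doubles it, so that R, C and S can be found from c and t + 3 further lines, leaving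
-- n^(t+4) possibilities, whereas the costs of guessing are absorbed by n > 2^t ≥ (4t + 26)².
module Submission where

open import Defs
open import Data.Bool.Base using (Bool; true; false; if_then_else_)
open import Data.Bool.Properties using () renaming (_≟_ to _≟ᵇ_)
open import Data.Empty using (⊥; ⊥-elim)
open import Data.Fin.Base using (Fin; zero; suc; toℕ; fromℕ<; inject≤)
open import Data.Fin.Properties using (_≟_; any?; all?; injective⇒≤; toℕ<n; toℕ-injective; toℕ-fromℕ<; pigeonhole; suc-injective; inject≤-injective)
open import Data.Fin.Subset using (Subset; _∈_; _∉_; ∣_∣; ∁; _∩_)
open import Data.Fin.Subset.Properties using (_∈?_; ⊆-antisym; ∣∁p∣≡n∸∣p∣; x∈∁p⇒x∉p; anySubset?; x∈p∩q⁺; x∈p∩q⁻; p⊆q⇒∣p∣≤∣q∣)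
import Data.Integer.Base as ℤ
import Data.Integer.Properties as ℤ
open import Data.List.Base as List using (List; []; _∷_; length; filter; allFin; map; _++_; cartesianProduct)
open import Data.List.Membership.Propositional using () renaming (_∈_ to _∈ˡ_)
open import Data.List.Membership.Propositional.Properties using (∈-lookup; ∈-filter⁺; ∈-filter⁻; ∈-tabulate⁺; ∈-tabulate⁻; ∈-cartesianProductWith⁻; ∈-allFin; ∈-++⁻; ∈-map⁻; ∈-cartesianProduct⁺; ∈-cartesianProduct⁻; ∈-map⁺)
open import Data.List.Properties as Listₚ using (filter-≐)
import Data.List.Relation.Unary.All as All
import Data.List.Relation.Unary.AllPairs as AllPairs
open import Data.List.Relation.Unary.Any using (index; here; there)
open import Data.List.Relation.Unary.Any.Properties using (lookup-index)
open import Data.List.Relation.Unary.Unique.Propositional using (Unique)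
import Data.List.Relation.Unary.Unique.Propositional.Properties as Unique
open import Data.Maybe.Base using (Maybe; just; nothing)
open import Data.Nat.Base using (ℕ; zero; suc; _+_; _*_; _∸_; _≤_; _<_; z≤n; s≤s; s≤s⁻¹; _^_; NonZero; _⊔_; >-nonZero)
open import Data.Nat.DivMod using (_%_; _mod_; m<n⇒m%n≡m; %-distribˡ-+; [m+n]%n≡m%n; m%n%n≡m%n)
open import Data.Nat.ListAction using (sum)
import Data.Nat.Properties as ℕ
open import Data.Nat.Solver using (module +-*-Solver)
open import Data.Product.Base using (_×_; _,_; ∃-syntax; Σ-syntax; proj₁; proj₂)
open import Data.Rational.Base as ℚ using (_/_)
import Data.Rational.Properties as ℚ
import Data.Rational.Unnormalised.Base as ℚᵘ
import Data.Rational.Unnormalised.Properties as ℚᵘ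
open import Data.Sum.Base using (_⊎_; inj₁; inj₂)
open import Data.Unit.Base using (⊤; tt)
open import Data.Vec.Base as Vec using (Vec; []; _∷_; lookup; tabulate; here; there)
open import Data.Vec.Properties using (lookup∘tabulate; lookup-map; tabulate∘lookup; tabulate-cong; lookup⇒[]=)
open import Function.Base using (_∘_; id)
open import Function.Bundles using (mk⇔)
open import Function.Definitions using (Injective)
open import Relation.Binary.PropositionalEquality
open import Relation.Nullary using (¬_; Dec; yes; no; contradiction)
open import Relation.Nullary.Decidable using (does; ¬?; _×-dec_; _→-dec_; decidable-stable; dec-true; dec-false; does-⇔; _⊎-dec_; toWitness)

-- Injections and permutations of finite sets

Inj : {A B : Set} → (A → B) → Set
Inj = Injective _≡_ _≡_

lookup-injective : {A : Set} {xs : List A} → Unique xs → Inj (List.lookup xs)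
lookup-injective (x∉ AllPairs.∷ u) {zero} {zero} eq = refl
lookup-injective (x∉ AllPairs.∷ u) {zero} {suc j} eq = ⊥-elim (All.lookup x∉ (∈-lookup j) eq)
lookup-injective (x∉ AllPairs.∷ u) {suc i} {zero} eq = ⊥-elim (All.lookup x∉ (∈-lookup i) (sym eq))
lookup-injective (x∉ AllPairs.∷ u) {suc i} {suc j} eq = cong suc (lookup-injective u eq)

-- Any choice of images is injective, because an image determines its source. The relational form is
-- used since the results of the switching are only shown to exist.
length-injective : {A B : Set} {xs : List A} {ys : List B} (Rel : A → B → Set) → Unique xs →
  (∀ {x} → x ∈ˡ xs → ∃[ y ] y ∈ˡ ys × Rel x y) →
  (∀ {x x′ y} → Rel x y → Rel x′ y → x ≡ x′) → length xs ≤ length ys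
length-injective {xs = xs} {ys} Rel u total inj = injective⇒≤ {f = f} f-inj
  where
  image : ∀ i → ∃[ y ] y ∈ˡ ys × Rel (List.lookup xs i) y
  image i = total (∈-lookup i)
  f : Fin (length xs) → Fin (length ys)
  f i = index (proj₁ (proj₂ (image i)))
  f-inj : Inj f
  f-inj {i} {j} eq = lookup-injective u (inj (proj₂ (proj₂ (image i)))
    (subst (Rel (List.lookup xs j)) (sym y≡) (proj₂ (proj₂ (image j)))))
    where
    y≡ : proj₁ (image i) ≡ proj₁ (image j)
    y≡ = trans (lookup-index (proj₁ (proj₂ (image i))))
      (trans (cong (List.lookup ys) eq) (sym (lookup-index (proj₁ (proj₂ (image j))))))

cons : {A : Set} {n : ℕ} → A → (Fin n → A) → Fin (suc n) → A
cons x f zero = x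
cons x f (suc i) = f i

cons-injective : {A : Set} {n : ℕ} (x : A) (f : Fin n → A) → Inj f → (∀ i → f i ≢ x) → Inj (cons x f)
cons-injective x f inj new {zero} {zero} eq = refl
cons-injective x f inj new {zero} {suc j} eq = ⊥-elim (new j (sym eq))
cons-injective x f inj new {suc i} {zero} eq = ⊥-elim (new i eq)
cons-injective x f inj new {suc i} {suc j} eq = cong suc (inj eq)

-- A missed `y` could be put in front of `f`, giving an injection of n + 1 elements into n.
injective⇒surjective : ∀ {n} (f : Fin n → Fin n) → Inj f → ∀ y → ∃[ x ] f x ≡ y
injective⇒surjective {n} f inj y with any? (λ x → f x ≟ y)
... | yes hit = hit
... | no ¬hit = ⊥-elim (ℕ.<-irrefl refl
      (injective⇒≤ {f = cons y f} (cons-injective y f inj (λ i eq → ¬hit (i , eq)))))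

-- Otherwise a choice of preimages would inject `Fin n` into `Fin k`.
missed-value : ∀ {k n} (f : Fin k → Fin n) → k < n → ∃[ y ] ∀ i → f i ≢ y
missed-value {k} {n} f k<n with any? (λ y → all? (λ i → ¬? (f i ≟ y)))
... | yes (y , new) = y , new
... | no ¬new = ⊥-elim (ℕ.<⇒≱ k<n (injective⇒≤ {f = proj₁ ∘ hit} hit-inj))
  where
  hit : ∀ y → ∃[ i ] f i ≡ y
  hit y with any? (λ i → f i ≟ y)
  ... | yes h = h
  ... | no ¬h = ⊥-elim (¬new (y , λ i eq → ¬h (i , eq)))
  hit-inj : Inj (proj₁ ∘ hit)
  hit-inj {y} {y′} eq = trans (sym (proj₂ (hit y))) (trans (cong f eq) (proj₂ (hit y′)))

-- If k < n, matching the entries of two columns row by row gives only a partial injection of the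
-- symbols. Pairing missed values one at a time makes it a permutation; `d` counts those still to be
-- paired.
extend-injection : ∀ d {k n} → d + k ≡ n → (a b : Fin k → Fin n) → Inj a → Inj b →
  Σ[ σ ∈ (Fin n → Fin n) ] Inj σ × (∀ i → σ (b i) ≡ a i)
extend-injection zero {k} refl a b a-inj b-inj = a ∘ b⁻¹ , (λ eq → b⁻¹-inj (a-inj eq)) , λ i → cong a (b-inj (b∘b⁻¹ (b i)))
  where
  b⁻¹ : Fin k → Fin k
  b⁻¹ y = proj₁ (injective⇒surjective b b-inj y)
  b∘b⁻¹ : ∀ y → b (b⁻¹ y) ≡ y
  b∘b⁻¹ y = proj₂ (injective⇒surjective b b-inj y)
  b⁻¹-inj : Inj b⁻¹
  b⁻¹-inj {x} {y} eq = trans (sym (b∘b⁻¹ x)) (trans (cong b eq) (b∘b⁻¹ y))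
extend-injection (suc d) {k} {n} eq a b a-inj b-inj =
  let (σ , σ-inj , σ∘b) = extend-injection d (trans (ℕ.+-suc d k) eq)
        (cons (proj₁ newᵃ) a) (cons (proj₁ newᵇ) b)
        (cons-injective _ a a-inj (proj₂ newᵃ)) (cons-injective _ b b-inj (proj₂ newᵇ))
  in σ , σ-inj , λ i → σ∘b (suc i)
  where
  k<n : k < n
  k<n = subst (suc k ≤_) eq (s≤s (ℕ.m≤n+m k d))
  newᵃ = missed-value a k<n
  newᵇ = missed-value b k<n

opaque
  swap : ∀ {n} → Fin n → Fin n → Fin n → Fin n
  swap a b x with x ≟ a
  ... | yes _ = b
  ... | no _ with x ≟ b
  ...   | yes _ = a
  ...   | no _ = x

  swap-left : ∀ {n} (a b : Fin n) → swap a b a ≡ b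
  swap-left a b with a ≟ a
  ... | yes _ = refl
  ... | no ¬p = contradiction refl ¬p

  swap-right : ∀ {n} (a b : Fin n) → swap a b b ≡ a
  swap-right a b with b ≟ a
  ... | yes b≡a = b≡a
  ... | no _ with b ≟ b
  ...   | yes _ = refl
  ...   | no ¬p = contradiction refl ¬p

  swap-other : ∀ {n} (a b : Fin n) {x} → x ≢ a → x ≢ b → swap a b x ≡ x
  swap-other a b {x} x≢a x≢b with x ≟ a
  ... | yes p = contradiction p x≢a
  ... | no _ with x ≟ b
  ...   | yes p = contradiction p x≢b
  ...   | no _ = refl

  swap-cases : ∀ {n} (a b x : Fin n) → (x ≡ a × swap a b x ≡ b) ⊎ (x ≡ b × swap a b x ≡ a) ⊎ (x ≢ a × x ≢ b × swap a b x ≡ x)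
  swap-cases a b x with x ≟ a
  ... | yes p = inj₁ (p , refl)
  ... | no x≢a with x ≟ b
  ...   | yes p = inj₂ (inj₁ (p , refl))
  ...   | no x≢b = inj₂ (inj₂ (x≢a , x≢b , refl))

swap-involutive : ∀ {n} (a b x : Fin n) → swap a b (swap a b x) ≡ x
swap-involutive a b x with swap-cases a b x
... | inj₁ (refl , eq) = trans (cong (swap a b) eq) (swap-right a b)
... | inj₂ (inj₁ (refl , eq)) = trans (cong (swap a b) eq) (swap-left a b)
... | inj₂ (inj₂ (_ , _ , eq)) = trans (cong (swap a b) eq) eq

swap-injective : ∀ {n} (a b : Fin n) → Inj (swap a b)
swap-injective a b {x} {y} eq = trans (sym (swap-involutive a b x)) (trans (cong (swap a b) eq) (swap-involutive a b y))

swap-natural : ∀ {m n} (f : Fin m → Fin n) → Inj f → ∀ a b x → swap (f a) (f b) (f x) ≡ f (swap a b x)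
swap-natural f inj a b x with swap-cases a b x
... | inj₁ (refl , eq) = trans (swap-left (f a) (f b)) (cong f (sym eq))
... | inj₂ (inj₁ (refl , eq)) = trans (swap-right (f a) (f b)) (cong f (sym eq))
... | inj₂ (inj₂ (x≢a , x≢b , eq)) = trans (swap-other _ _ (x≢a ∘ inj) (x≢b ∘ inj)) (cong f (sym eq))

-- Orbits of a permutation

iterate : {A : Set} → (A → A) → ℕ → A → A
iterate f zero x = x
iterate f (suc i) x = f (iterate f i x)

iterate-+ : {A : Set} (f : A → A) → Inj f → ∀ i d x → iterate f (i + d) x ≡ iterate f i x → iterate f d x ≡ x
iterate-+ f inj zero d x eq = eq
iterate-+ f inj (suc i) d x eq = iterate-+ f inj i d x (inj eq)

-- Two of the first n + 1 iterates agree, and cancelling the smaller exponent leaves a positive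
-- period.
iterate-returns : ∀ {n} (σ : Fin n → Fin n) → Inj σ → ∀ x → ∃[ d ] iterate σ (suc d) x ≡ x
iterate-returns {n} σ inj x with pigeonhole (ℕ.n<1+n n) (λ (i : Fin (suc n)) → iterate σ (toℕ i) x)
... | i , j , i<j , eq = d , iterate-+ σ inj (toℕ i) (suc d) x
    (trans (cong (λ e → iterate σ e x) (trans (ℕ.+-suc (toℕ i) d) (ℕ.m+[n∸m]≡n i<j))) (sym eq))
  where d = toℕ j ∸ suc (toℕ i)

first-time : {P : ℕ → Set} → (∀ i → Dec (P i)) → ∀ d → P d → ∃[ j ] P j × (∀ i → i < j → ¬ P i)
first-time P? zero pd = 0 , pd , λ i ()
first-time P? (suc d) pd with P? 0
... | yes p0 = 0 , p0 , λ i ()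
... | no ¬p0 with first-time (λ i → P? (suc i)) d pd
...   | j , pj , before = suc j , pj , λ where
        zero _ → ¬p0
        (suc i) (s≤s i<j) → before i i<j

-- The orbit is the σ-orbit of V zero, cut at its first return V x to V and closed up there.
close-up : ∀ {n g} (σ : Fin n → Fin n) → Inj σ → (V : Fin (suc g) → Fin n) →
  ∃[ x ] Σ[ orbit ∈ (Fin n → Bool) ]
    orbit (V zero) ≡ true
    × (∀ z → V z ≢ V zero → orbit (V z) ≡ false)
    × (∀ w → orbit w ≡ orbit (swap (V zero) (V x) (σ w)))
close-up {n} {g} σ σ-inj V = target , orbit , orbit-v , orbit-V , orbit-step
  where
  v : Fin n
  v = V zero

  inV? : ∀ i → Dec (∃[ x ] iterate σ (suc i) v ≡ V x)
  inV? i = any? (λ x → iterate σ (suc i) v ≟ V x)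

  -- `v` is itself a value of `V`, so its orbit does return to `V`; minimality keeps the iterates in
  -- between away from all values of `V`.
  return = let (d , eq) = iterate-returns σ σ-inj v in first-time inV? d (zero , eq)

  j : ℕ
  j = proj₁ return

  Orbit : Fin n → Set
  Orbit w = ∃[ i ] w ≡ iterate σ (toℕ {suc j} i) v

  target : Fin (suc g)
  target = proj₁ (proj₁ (proj₂ return))

  y : Fin n
  y = V target

  return≡ : iterate σ (suc j) v ≡ y
  return≡ = proj₂ (proj₁ (proj₂ return))

  early : ∀ i → i < j → ∀ x → iterate σ (suc i) v ≢ V x
  early i i<j x eq = proj₂ (proj₂ return) i i<j (x , eq)

  orbit? : ∀ w → Dec (Orbit w)
  orbit? w = any? (λ i → w ≟ iterate σ (toℕ i) v)

  at : ∀ i → i < suc j → Orbit (iterate σ i v)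
  at i i< = fromℕ< i< , cong (λ e → iterate σ e v) (sym (toℕ-fromℕ< i<))

  -- Before the return the iterate is no value of `V`, so the swap fixes it; at the return the swap
  -- sends `y` to `v` and closes the cycle.
  forth : ∀ {w} → Orbit w → Orbit (swap v y (σ w))
  forth (i , refl) with ℕ.m≤n⇒m<n∨m≡n (s≤s⁻¹ (toℕ<n i))
  ... | inj₁ i<j = subst Orbit (sym (swap-other v y (early (toℕ i) i<j zero) (early (toℕ i) i<j target))) (at (suc (toℕ i)) (s≤s i<j))
  ... | inj₂ i≡j = zero , trans (cong (swap v y) (trans (cong (λ e → σ (iterate σ e v)) i≡j) return≡)) (swap-right v y)

  back : ∀ {w} → Orbit (swap v y (σ w)) → Orbit w
  back {w} (zero , eq) = subst Orbit (σ-inj (trans return≡ (sym σw≡y))) (at j (ℕ.n<1+n j))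
    where
    σw≡y : σ w ≡ y
    σw≡y = trans (sym (swap-involutive v y (σ w))) (trans (cong (swap v y) eq) (swap-left v y))
  back {w} (suc i , eq) = subst Orbit (sym (σ-inj σw≡)) (at (toℕ i) (ℕ.m<n⇒m<1+n (toℕ<n i)))
    where
    σw≡ : σ w ≡ iterate σ (suc (toℕ i)) v
    σw≡ = trans (sym (swap-involutive v y (σ w))) (trans (cong (swap v y) eq)
      (swap-other v y (early (toℕ i) (toℕ<n i) zero) (early (toℕ i) (toℕ<n i) target)))

  orbit : Fin n → Bool
  orbit w = does (orbit? w)

  orbit-v : orbit (V zero) ≡ true
  orbit-v = dec-true (orbit? v) (zero , refl)

  orbit-V : ∀ x → V x ≢ V zero → orbit (V x) ≡ false
  orbit-V x Vx≢v = dec-false (orbit? (V x)) λ where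
    (zero , eq) → Vx≢v eq
    (suc i , eq) → early (toℕ i) (toℕ<n i) x (sym eq)

  orbit-step : ∀ w → orbit w ≡ orbit (swap (V zero) (V target) (σ w))
  orbit-step w = does-⇔ (mk⇔ forth back) (orbit? w) (orbit? (swap v y (σ w)))

-- Switching

vec-ext : {A : Set} {n : ℕ} {u w : Vec A n} → (∀ i → lookup u i ≡ lookup w i) → u ≡ w
vec-ext {u = u} {w} eq = trans (sym (tabulate∘lookup u)) (trans (tabulate-cong eq) (tabulate∘lookup w))

opaque
  matrix : ∀ {k n} → (Fin k → Fin n → Fin n) → Matrix k n
  matrix f = tabulate λ i → tabulate λ j → f i j

  entry-matrix : ∀ {k n} (f : Fin k → Fin n → Fin n) i j → entry (matrix f) i j ≡ f i j
  entry-matrix f i j = trans (cong (λ row → lookup row j) (lookup∘tabulate _ i)) (lookup∘tabulate _ j)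

matrix-ext : ∀ {k n} {h h′ : Matrix k n} → (∀ i j → entry h i j ≡ entry h′ i j) → h ≡ h′
matrix-ext eq = vec-ext λ i → vec-ext (eq i)

bool-cases : ∀ b → b ≡ true ⊎ b ≡ false
bool-cases true = inj₁ refl
bool-cases false = inj₂ refl

module _ {k n : ℕ} where

  opaque
    flip : (c c′ : Fin n) → Subset k → Matrix k n → Matrix k n
    flip c c′ Z h = matrix λ i j → entry h i (if lookup Z i then swap c c′ j else j)

  -- These are the unions of components when rows are joined if the same symbol stands in column `c`
  -- of one and in column `c′` of the other.
  Closed : (c c′ : Fin n) → Matrix k n → Subset k → Set
  Closed c c′ h Z = ∀ i i′ → entry h i c ≡ entry h i′ c′ → lookup Z i ≡ lookup Z i′

  module _ {c c′ : Fin n} {Z : Subset k} {h : Matrix k n} where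

    opaque
      unfolding flip

      flip-in : ∀ {i} j → lookup Z i ≡ true → entry (flip c c′ Z h) i j ≡ entry h i (swap c c′ j)
      flip-in {i} j Zi = trans (entry-matrix _ i j) (cong (λ b → entry h i (if b then swap c c′ j else j)) Zi)

      flip-out : ∀ {i} j → lookup Z i ≡ false → entry (flip c c′ Z h) i j ≡ entry h i j
      flip-out {i} j Zi = trans (entry-matrix _ i j) (cong (λ b → entry h i (if b then swap c c′ j else j)) Zi)

    flip-other : ∀ i {j} → j ≢ c → j ≢ c′ → entry (flip c c′ Z h) i j ≡ entry h i j
    flip-other i {j} j≢c j≢c′ with bool-cases (lookup Z i)
    ... | inj₁ Zi = trans (flip-in j Zi) (cong (entry h i) (swap-other c c′ j≢c j≢c′))
    ... | inj₂ Zi = flip-out j Zi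

  flip-involutive : ∀ c c′ Z h → flip c c′ Z (flip c c′ Z h) ≡ h
  flip-involutive c c′ Z h = matrix-ext λ i j → go i j (bool-cases (lookup Z i))
    where
    go : ∀ i j → lookup Z i ≡ true ⊎ lookup Z i ≡ false → entry (flip c c′ Z (flip c c′ Z h)) i j ≡ entry h i j
    go i j (inj₁ Zi) = trans (flip-in j Zi) (trans (flip-in _ Zi) (cong (entry h i) (swap-involutive c c′ j)))
    go i j (inj₂ Zi) = trans (flip-out j Zi) (flip-out j Zi)

  -- Two rows in the same state are compared within one column of `h`. A clash between a flipped and
  -- an unflipped row in `c` or `c′` would need equal symbols in these two columns of `h`, which
  -- `Closed` excludes.
  flip-isLatin : ∀ {c c′ Z h} → Closed c c′ h Z → IsLatin h → IsLatin (flip c c′ Z h)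
  flip-isLatin {c} {c′} {Z} {h} closed (rowInj , colInj) = rows , cols
    where
    rows : ∀ i j j′ → entry (flip c c′ Z h) i j ≡ entry (flip c c′ Z h) i j′ → j ≡ j′
    rows i j j′ eq with bool-cases (lookup Z i)
    ... | inj₁ Zi = swap-injective c c′ (rowInj i _ _ (trans (sym (flip-in j Zi)) (trans eq (flip-in j′ Zi))))
    ... | inj₂ Zi = rowInj i j j′ (trans (sym (flip-out j Zi)) (trans eq (flip-out j′ Zi)))

    mixed : ∀ {i i′} j → lookup Z i ≡ true → lookup Z i′ ≡ false → entry h i (swap c c′ j) ≢ entry h i′ j
    mixed {i} {i′} j Zi Zi′ eq with swap-cases c c′ j
    ... | inj₁ (refl , s) = contradiction (trans (sym Zi) (trans (sym (closed i′ i (sym (trans (cong (entry h i) (sym s)) eq)))) Zi′)) λ ()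
    ... | inj₂ (inj₁ (refl , s)) = contradiction (trans (sym Zi) (trans (closed i i′ (trans (cong (entry h i) (sym s)) eq)) Zi′)) λ ()
    ... | inj₂ (inj₂ (_ , _ , s)) = contradiction (trans (sym Zi) (trans (cong (lookup Z) (colInj j i i′ (trans (cong (entry h i) (sym s)) eq))) Zi′)) λ ()

    cols : ∀ j i i′ → entry (flip c c′ Z h) i j ≡ entry (flip c c′ Z h) i′ j → i ≡ i′
    cols j i i′ eq with bool-cases (lookup Z i) | bool-cases (lookup Z i′)
    ... | inj₁ Zi | inj₁ Zi′ = colInj _ i i′ (trans (sym (flip-in j Zi)) (trans eq (flip-in j Zi′)))
    ... | inj₂ Zi | inj₂ Zi′ = colInj _ i i′ (trans (sym (flip-out j Zi)) (trans eq (flip-out j Zi′)))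
    ... | inj₁ Zi | inj₂ Zi′ = ⊥-elim (mixed j Zi Zi′ (trans (sym (flip-in j Zi)) (trans eq (flip-out j Zi′))))
    ... | inj₂ Zi | inj₁ Zi′ = ⊥-elim (mixed j Zi′ Zi (trans (sym (flip-in j Zi′)) (trans (sym eq) (flip-out j Zi))))

  -- If both rows are flipped, the equation between their entries is reversed; if exactly one is,
  -- both entries come from one column of `h` and the rows coincide.
  Closed-flip : ∀ {c c′ Z Z′ h} → IsLatin h → Closed c c′ h Z → Closed c c′ h Z′ → Closed c c′ (flip c c′ Z h) Z′
  Closed-flip {c} {c′} {Z} {Z′} {h} (_ , colInj) cl cl′ i i′ eq
    with bool-cases (lookup Z i) | bool-cases (lookup Z i′)
  ... | inj₁ Zi | inj₁ Zi′ = sym (cl′ i′ i (trans (cong (entry h i′) (sym (swap-right c c′)))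
          (trans (sym (flip-in c′ Zi′)) (trans (sym eq) (trans (flip-in c Zi) (cong (entry h i) (swap-left c c′)))))))
  ... | inj₂ Zi | inj₂ Zi′ = cl′ i i′ (trans (sym (flip-out c Zi)) (trans eq (flip-out c′ Zi′)))
  ... | inj₁ Zi | inj₂ Zi′ = cong (lookup Z′) (colInj c′ i i′ (trans (cong (entry h i) (sym (swap-left c c′)))
          (trans (sym (flip-in c Zi)) (trans eq (flip-out c′ Zi′)))))
  ... | inj₂ Zi | inj₁ Zi′ = cong (lookup Z′) (colInj c i i′ (trans (sym (flip-out c Zi)) (trans eq
          (trans (flip-in c′ Zi′) (cong (entry h i′) (swap-right c c′))))))

  opaque
    -- For symbols of the subsquare this acts inside the subsquare only, since in the rows `R` they
    -- occur only in the columns `C`.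
    toggle : Subset k → (v y : Fin n) → Matrix k n → Matrix k n
    toggle R v y h = matrix λ i j → if does (i ∈? R) then swap v y (entry h i j) else entry h i j

  module _ {R : Subset k} {v y : Fin n} {h : Matrix k n} where

    opaque
      unfolding toggle

      toggle-in : ∀ {i} j → i ∈ R → entry (toggle R v y h) i j ≡ swap v y (entry h i j)
      toggle-in {i} j i∈ = trans (entry-matrix _ i j)
        (cong (λ b → if b then swap v y (entry h i j) else entry h i j) (dec-true (i ∈? R) i∈))

      toggle-out : ∀ {i} j → i ∉ R → entry (toggle R v y h) i j ≡ entry h i j
      toggle-out {i} j i∉ = trans (entry-matrix _ i j)
        (cong (λ b → if b then swap v y (entry h i j) else entry h i j) (dec-false (i ∈? R) i∉))

  toggle-involutive : ∀ R v y h → toggle R v y (toggle R v y h) ≡ h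
  toggle-involutive R v y h = matrix-ext λ i j → go i j (i ∈? R)
    where
    go : ∀ i j → Dec (i ∈ R) → entry (toggle R v y (toggle R v y h)) i j ≡ entry h i j
    go i j (yes i∈) = trans (toggle-in j i∈) (trans (cong (swap v y) (toggle-in j i∈)) (swap-involutive v y _))
    go i j (no i∉) = trans (toggle-out j i∉) (toggle-out j i∉)

-- A single step of the switching

module Isolate {k n : ℕ} (R : Subset k) (C : Subset n) (c : Fin n) where

  -- What a subsquare on `R` and `C` guarantees for one of its symbols. The subsquare is destroyed
  -- step by step, but this survives for the values that are still to be used.
  record Everywhere (h : Matrix k n) (q : Fin n) : Set where
    constructor everywhere
    field
      inRow : ∀ {i} → i ∈ R → ∃[ j ] j ∈ C × entry h i j ≡ q
      inCol : ∀ {j} → j ∈ C → ∃[ i ] i ∈ R × entry h i j ≡ q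
  open Everywhere public

  record Ready {g} (V : Vec (Fin n) (suc g)) (h : Matrix k n) : Set where
    constructor ready
    field
      latin    : IsLatin h
      c∈C      : c ∈ C
      distinct : Inj (lookup V)
      full     : ∀ x → Everywhere h (lookup V x)
  open Ready public

  module _ {h : Matrix k n} (latin : IsLatin h) {q : Fin n} (E : Everywhere h q) where

    onlyCols : ∀ {i j} → i ∈ R → entry h i j ≡ q → j ∈ C
    onlyCols {i} i∈ eq = let (_ , j∈ , eq′) = inRow E i∈ in subst (_∈ C) (proj₁ latin i _ _ (trans eq′ (sym eq))) j∈

    onlyRows : ∀ {i j} → j ∈ C → entry h i j ≡ q → i ∈ R
    onlyRows {i} {j} j∈ eq = let (_ , i∈ , eq′) = inCol E j∈ in subst (_∈ R) (proj₂ latin j _ _ (trans eq′ (sym eq))) i∈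

  -- A column in which the toggle changes something belongs to `C`; there `v` and `y` both occur
  -- inside `R`, so rows outside `R` cannot clash with the changed entries.
  toggle-isLatin : ∀ {h v y} → IsLatin h → Everywhere h v → Everywhere h y → IsLatin (toggle R v y h)
  toggle-isLatin {h} {v} {y} L Ev Ey = rows , cols
    where
    h′ = toggle R v y h

    rows : ∀ i j j′ → entry h′ i j ≡ entry h′ i j′ → j ≡ j′
    rows i j j′ eq with i ∈? R
    ... | yes i∈ = proj₁ L i j j′ (swap-injective v y (trans (sym (toggle-in j i∈)) (trans eq (toggle-in j′ i∈))))
    ... | no i∉ = proj₁ L i j j′ (trans (sym (toggle-out j i∉)) (trans eq (toggle-out j′ i∉)))

    mixed : ∀ {i i′} j → i ∈ R → i′ ∉ R → swap v y (entry h i j) ≢ entry h i′ j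
    mixed {i} {i′} j i∈ i′∉ eq with swap-cases v y (entry h i j)
    ... | inj₁ (e , s) = i′∉ (onlyRows L Ey (onlyCols L Ev i∈ e) (trans (sym eq) s))
    ... | inj₂ (inj₁ (e , s)) = i′∉ (onlyRows L Ev (onlyCols L Ey i∈ e) (trans (sym eq) s))
    ... | inj₂ (inj₂ (_ , _ , s)) = i′∉ (subst (_∈ R) (proj₂ L j i i′ (trans (sym s) eq)) i∈)

    cols : ∀ j i i′ → entry h′ i j ≡ entry h′ i′ j → i ≡ i′
    cols j i i′ eq with i ∈? R | i′ ∈? R
    ... | yes i∈ | yes i′∈ = proj₂ L j i i′ (swap-injective v y (trans (sym (toggle-in j i∈)) (trans eq (toggle-in j i′∈))))
    ... | no i∉ | no i′∉ = proj₂ L j i i′ (trans (sym (toggle-out j i∉)) (trans eq (toggle-out j i′∉)))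
    ... | yes i∈ | no i′∉ = ⊥-elim (mixed j i∈ i′∉ (trans (sym (toggle-in j i∈)) (trans eq (toggle-out j i′∉))))
    ... | no i∉ | yes i′∈ = ⊥-elim (mixed j i′∈ i∉ (trans (sym (toggle-in j i′∈)) (trans (sym eq) (toggle-out j i∉))))

  -- The conditions on Z mention c and c′ symmetrically, so they are not affected by flipping, and
  -- the set chosen by pick can be recovered from the flipped matrix.
  Good : ∀ {g} (c′ : Fin n) → Vec (Fin n) (suc g) → Matrix k n → Subset k → Set
  Good c′ (v ∷ V′) h Z = Closed c c′ h Z
    × (∀ i → i ∈ R → entry h i c ≡ v ⊎ entry h i c′ ≡ v → lookup Z i ≡ true)
    × (∀ i → i ∈ R → ∀ x → entry h i c ≡ lookup V′ x ⊎ entry h i c′ ≡ lookup V′ x → lookup Z i ≡ false)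

  opaque
    good? : ∀ {g} c′ (V : Vec (Fin n) (suc g)) h Z → Dec (Good c′ V h Z)
    good? c′ (v ∷ V′) h Z =
      (all? λ i → all? λ i′ → (entry h i c ≟ entry h i′ c′) →-dec (lookup Z i ≟ᵇ lookup Z i′))
      ×-dec (all? λ i → (i ∈? R) →-dec ((entry h i c ≟ v) ⊎-dec (entry h i c′ ≟ v)) →-dec (lookup Z i ≟ᵇ true))
      ×-dec (all? λ i → (i ∈? R) →-dec (all? λ x →
        ((entry h i c ≟ lookup V′ x) ⊎-dec (entry h i c′ ≟ lookup V′ x)) →-dec (lookup Z i ≟ᵇ false)))

    firstOr : Subset k → List (Subset k) → Subset k
    -- Taken only if no set is good; `Step` demands that the picked set is good.
    firstOr d [] = d
    firstOr d (Z ∷ _) = Z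

    pick : ∀ {g} (c′ : Fin n) → Vec (Fin n) (suc g) → Matrix k n → Subset k
    pick c′ V h = firstOr (Vec.replicate k false) (filter (good? c′ V h) (subsets k))

    pick-good : ∀ {g} c′ (V : Vec (Fin n) (suc g)) h {Z} → Good c′ V h Z → Good c′ V h (pick c′ V h)
    pick-good c′ V h {Z} good = go (filter (good? c′ V h) (subsets k))
        (λ Z∈ → proj₂ (∈-filter⁻ (good? c′ V h) {xs = subsets k} Z∈))
        (∈-filter⁺ (good? c′ V h) (∈-vectors {xs = true ∷ false ∷ []} (λ { true → here refl ; false → there (here refl) }) Z) good)
      where
      go : ∀ Zs → (∀ {Z} → Z ∈ˡ Zs → Good c′ V h Z) → Z ∈ˡ Zs → Good c′ V h (firstOr (Vec.replicate k false) Zs)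
      go (Z ∷ _) all _ = all (here refl)

    pick-cong : ∀ {g} c′ (V : Vec (Fin n) (suc g)) h h′ → (∀ {Z} → Good c′ V h Z → Good c′ V h′ Z) →
      (∀ {Z} → Good c′ V h′ Z → Good c′ V h Z) → pick c′ V h ≡ pick c′ V h′
    pick-cong c′ V h h′ to from = cong (firstOr (Vec.replicate k false)) (filter-≐ (good? c′ V h) (good? c′ V h′) (to , from) (subsets k))

  Good-flip : ∀ {g} {c′} {V : Vec (Fin n) (suc g)} {h Z Z′} → IsLatin h → Closed c c′ h Z →
    Good c′ V h Z′ → Good c′ V (flip c c′ Z h) Z′
  Good-flip {c′ = c′} {v ∷ V′} {h} {Z} {Z′} L cl (cl′ , in′ , out′) =
    Closed-flip {Z = Z} {Z′} {h} L cl cl′ ,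
    (λ i i∈ eq → in′ i i∈ (unordered i v eq)) ,
    (λ i i∈ x eq → out′ i i∈ x (unordered i (lookup V′ x) eq))
    where
    h′ = flip c c′ Z h
    unordered : ∀ i q → entry h′ i c ≡ q ⊎ entry h′ i c′ ≡ q → entry h i c ≡ q ⊎ entry h i c′ ≡ q
    unordered i q eq with bool-cases (lookup Z i) | eq
    ... | inj₁ Zi | inj₁ e = inj₂ (trans (cong (entry h i) (sym (swap-left c c′))) (trans (sym (flip-in c Zi)) e))
    ... | inj₁ Zi | inj₂ e = inj₁ (trans (cong (entry h i) (sym (swap-right c c′))) (trans (sym (flip-in c′ Zi)) e))
    ... | inj₂ Zi | inj₁ e = inj₁ (trans (sym (flip-out c Zi)) e)
    ... | inj₂ Zi | inj₂ e = inj₂ (trans (sym (flip-out c′ Zi)) e)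

  flipPick : ∀ {g} (c′ : Fin n) → Vec (Fin n) (suc g) → Matrix k n → Matrix k n
  flipPick c′ V h = flip c c′ (pick c′ V h) h

  -- The flip leaves the family of good sets as it was, so the same set is picked again and the
  -- second flip undoes the first.
  flipPick-involutive : ∀ {g} c′ (V : Vec (Fin n) (suc g)) h → IsLatin h → Good c′ V h (pick c′ V h) →
    flipPick c′ V (flipPick c′ V h) ≡ h
  flipPick-involutive c′ V@(_ ∷ _) h L good@(cl , _) =
    trans (cong (λ Z → flip c c′ Z h′) (pick-cong c′ V h′ h (λ {Z′} → from {Z′}) (λ {Z′} → Good-flip {V = V} {Z = Z} {Z′} L cl))) (flip-involutive c c′ Z h)
    where
    Z = pick c′ V h
    h′ = flip c c′ Z h
    from : ∀ {Z′} → Good c′ V h′ Z′ → Good c′ V h Z′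
    from {Z′} good′ = subst (λ h → Good c′ V h Z′) (flip-involutive c c′ Z h)
      (Good-flip {V = V} {Z = Z} {Z′} (flip-isLatin {Z = Z} {h} cl L) (Closed-flip {Z = Z} {Z} {h} L cl cl) good′)

  -- The index `x` is the guess to be recorded, whereas `c′` and `h` will be recovered from `h′`.
  -- Toggling comes first, so that a closed set can contain `v` and avoid the other values.
  record Step {g} (V : Vec (Fin n) (suc g)) (c′ : Fin n) (x : Fin (suc g)) (h h′ : Matrix k n) : Set where
    constructor step
    field
      isReady : Ready V h
      c′∉C    : c′ ∉ C
      isGood  : Good c′ V (toggle R (lookup V zero) (lookup V x) h) (pick c′ V (toggle R (lookup V zero) (lookup V x) h))
      result  : h′ ≡ flipPick c′ V (toggle R (lookup V zero) (lookup V x) h)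

  -- In each row `σ` leads from the entry in `c′` to the entry in `c`, and toggling composes it with
  -- the swap. A set of symbols invariant under this composite therefore gives a closed set of rows.
  closed-up : ∀ {g} {V : Vec (Fin n) (suc g)} {c′ h} → Ready V h → c′ ∉ C →
    (σ : Fin n → Fin n) → (∀ i → σ (entry h i c′) ≡ entry h i c) → ∀ x (orbit : Fin n → Bool) →
    orbit (lookup V zero) ≡ true → (∀ z → lookup V z ≢ lookup V zero → orbit (lookup V z) ≡ false) →
    (∀ w → orbit w ≡ orbit (swap (lookup V zero) (lookup V x) (σ w))) → ∃[ x ] ∃[ h′ ] Step V c′ x h h′
  closed-up {g} {V@(v ∷ V′)} {c′} {h} rdy c′∉ σ σ∘b x orbit orbit-v orbit-V orbit-step =
    x , _ , step rdy c′∉ (pick-good c′ V hᵗ {Z} (closed , isolated-in , isolated-out)) refl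
    where
    L = latin rdy
    a b : Fin k → Fin n
    a i = entry h i c
    b i = entry h i c′
    y = lookup V x
    hᵗ = toggle R v y h

    atᶜ : ∀ i → entry hᵗ i c ≡ swap v y (a i)
    atᶜ i with i ∈? R
    ... | yes i∈ = toggle-in c i∈
    -- Column `c` has `v` and `y` inside `R`, hence neither of them outside.
    ... | no i∉ = trans (toggle-out c i∉) (sym (swap-other v y (i∉ ∘ onlyRows L (full rdy zero) (c∈C rdy)) (i∉ ∘ onlyRows L (full rdy x) (c∈C rdy))))

    -- In a row of `R` the values of `V` stand in columns of `C`, and `c′` is not one of these; the
    -- conditions of `Good` on column `c′` thus hold vacuously.
    outside : ∀ {i} → i ∈ R → ∀ z → b i ≢ lookup V z
    outside i∈ z eq = c′∉ (onlyCols L (full rdy z) i∈ eq)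

    atᶜ′ : ∀ i → entry hᵗ i c′ ≡ b i
    atᶜ′ i with i ∈? R
    ... | yes i∈ = trans (toggle-in c′ i∈) (swap-other v y (outside i∈ zero) (outside i∈ x))
    ... | no i∉ = toggle-out c′ i∉

    Z : Subset k
    Z = tabulate λ i → orbit (entry hᵗ i c)

    lookup-Z : ∀ i → lookup Z i ≡ orbit (entry hᵗ i c)
    lookup-Z i = lookup∘tabulate _ i

    closed : Closed c c′ hᵗ Z
    closed i i′ eq = begin
      lookup Z i                          ≡⟨ lookup-Z i ⟩
      orbit (entry hᵗ i c)                ≡⟨ cong orbit (trans eq (atᶜ′ i′)) ⟩
      orbit (b i′)                        ≡⟨ orbit-step (b i′) ⟩
      orbit (swap v y (σ (b i′)))         ≡⟨ cong (orbit ∘ swap v y) (σ∘b i′) ⟩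
      orbit (swap v y (a i′))             ≡⟨ cong orbit (atᶜ i′) ⟨
      orbit (entry hᵗ i′ c)               ≡⟨ lookup-Z i′ ⟨
      lookup Z i′                         ∎
      where open ≡-Reasoning

    isolated-in : ∀ i → i ∈ R → entry hᵗ i c ≡ v ⊎ entry hᵗ i c′ ≡ v → lookup Z i ≡ true
    isolated-in i i∈ (inj₁ eq) = trans (lookup-Z i) (trans (cong orbit eq) orbit-v)
    isolated-in i i∈ (inj₂ eq) = ⊥-elim (outside i∈ zero (trans (sym (atᶜ′ i)) eq))

    isolated-out : ∀ i → i ∈ R → ∀ z → entry hᵗ i c ≡ lookup V′ z ⊎ entry hᵗ i c′ ≡ lookup V′ z → lookup Z i ≡ false
    isolated-out i i∈ z (inj₁ eq) = trans (lookup-Z i) (trans (cong orbit eq)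
      (orbit-V (suc z) (λ e → contradiction (distinct rdy {suc z} {zero} e) λ ())))
    isolated-out i i∈ z (inj₂ eq) = ⊥-elim (outside i∈ (suc z) (trans (sym (atᶜ′ i)) eq))

  step-exists : ∀ {g} {V : Vec (Fin n) (suc g)} {c′ h} → Ready V h → c′ ∉ C → ∃[ x ] ∃[ h′ ] Step V c′ x h h′
  step-exists {V = V} {c′} {h} rdy c′∉ =
    let (σ , σ-inj , σ∘b) = extend-injection (n ∸ k) (ℕ.m∸n+n≡m (injective⇒≤ (λ {i} {i′} → a-inj {i} {i′}))) _ _ a-inj b-inj
        (x , orbit , orbit-v , orbit-V , orbit-step) = close-up σ σ-inj (lookup V)
    in closed-up rdy c′∉ σ σ∘b x orbit orbit-v orbit-V orbit-step
    where
    a-inj : Inj (λ i → entry h i c)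
    a-inj = proj₂ (latin rdy) c _ _
    b-inj : Inj (λ i → entry h i c′)
    b-inj = proj₂ (latin rdy) c′ _ _

  module _ {g} {V : Vec (Fin n) (suc g)} {c′ x h h′} (s : Step V c′ x h h′) where
    open Step s
    private
      v = lookup V zero
      y = lookup V x
      hᵗ = toggle R v y h
      L = latin isReady

    toggled-isLatin : IsLatin hᵗ
    toggled-isLatin = toggle-isLatin L (full isReady zero) (full isReady x)

    closed-pick : Closed c c′ hᵗ (pick c′ V hᵗ)
    closed-pick = go V isGood
      where
      go : ∀ (V : Vec (Fin n) (suc g)) {Z} → Good c′ V hᵗ Z → Closed c c′ hᵗ Z
      go (_ ∷ _) = proj₁

    step-isLatin : IsLatin h′
    step-isLatin = subst IsLatin (sym result) (flip-isLatin closed-pick toggled-isLatin)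

    step-other : ∀ {i j} → i ∈ R → j ∈ C → j ≢ c → entry h′ i j ≡ swap v y (entry h i j)
    step-other {i} {j} i∈ j∈ j≢c = trans (cong (λ m → entry m i j) result)
      (trans (flip-other {h = hᵗ} i j≢c (λ eq → c′∉C (subst (_∈ C) eq j∈))) (toggle-in j i∈))

  -- The picked set avoids the rows of `R` where column `c` holds a remaining value after toggling.
  step-kept : ∀ {g v} {V : Vec (Fin n) (suc g)} {c′ x h h′} (s : Step (v ∷ V) c′ x h h′) {i} → i ∈ R → ∀ z →
    swap v (lookup (v ∷ V) x) (entry h i c) ≡ lookup V z → entry h′ i c ≡ swap v (lookup (v ∷ V) x) (entry h i c)
  step-kept {V = V} {h = h} s {i} i∈ z eq = trans (cong (λ m → entry m i c) result)
      (trans (flip-out c (proj₂ (proj₂ isGood) i i∈ z (inj₁ (trans (toggle-in c i∈) eq)))) (toggle-in c i∈))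
    where open Step s

  -- The displaced `v` marks the column `c′`, which makes the step reversible.
  step-moved : ∀ {g} {V : Vec (Fin n) (suc g)} {c′ x h h′} (s : Step V c′ x h h′) {i} → i ∈ R →
    entry (toggle R (lookup V zero) (lookup V x) h) i c ≡ lookup V zero → entry h′ i c′ ≡ lookup V zero
  step-moved {V = v ∷ V} {c′} {x} {h} s {i} i∈ eq = trans (cong (λ m → entry m i c′) result)
      (trans (flip-in c′ (proj₁ (proj₂ isGood) i i∈ (inj₁ eq))) (trans (cong (entry hᵗ i) (swap-right c c′)) eq))
    where
    open Step s
    hᵗ = toggle R v (lookup (v ∷ V) x) h

  -- A remaining value stands after the step where its preimage under the exchange of `v` and `y`
  -- stood before: outside column `c` nothing else happens, and in column `c` it is kept. `source`
  -- is this preimage.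
  step-ready : ∀ {g v} {V : Vec (Fin n) (suc g)} {c′ x h h′} → Step (v ∷ V) c′ x h h′ → Ready V h′
  step-ready {g} {v} {V} {c′} {x} {h} {h′} s = ready (step-isLatin s) (c∈C isReady)
      (λ {z} {z′} eq → suc-injective (distinct isReady {suc z} {suc z′} eq)) λ z → everywhere (row z) (col z)
    where
    open Step s
    y = lookup (v ∷ V) x
    source : ∀ z → ∃[ z′ ] swap v y (lookup (v ∷ V) z′) ≡ lookup V z
    source z = swap zero x (suc z) , trans (swap-natural (lookup (v ∷ V)) (λ {a} {b} → distinct isReady {a} {b}) zero x _) (cong (lookup (v ∷ V)) (swap-involutive zero x (suc z)))

    transfer : ∀ z {i j} → i ∈ R → j ∈ C → entry h i j ≡ lookup (v ∷ V) (proj₁ (source z)) → entry h′ i j ≡ lookup V z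
    transfer z {i} {j} i∈ j∈ eq with j ≟ c
    ... | no j≢c = trans (step-other s i∈ j∈ j≢c) (trans (cong (swap v y) eq) (proj₂ (source z)))
    ... | yes refl = let e = trans (cong (swap v y) eq) (proj₂ (source z)) in trans (step-kept s i∈ z e) e

    row : ∀ z {i} → i ∈ R → ∃[ j ] j ∈ C × entry h′ i j ≡ lookup V z
    row z i∈ = let (j , j∈ , eq) = inRow (full isReady (proj₁ (source z))) i∈ in j , j∈ , transfer z i∈ j∈ eq

    col : ∀ z {j} → j ∈ C → ∃[ i ] i ∈ R × entry h′ i j ≡ lookup V z
    col z j∈ = let (i , i∈ , eq) = inCol (full isReady (proj₁ (source z))) j∈ in i , i∈ , transfer z i∈ j∈ eq

  -- Take the row of `R` where `h₁` has `y` in column `c`; in `h′` its `v` stands in `c₁`. According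
  -- to the second step it stands in `c₂` or in a column of `C`, and the latter is impossible as
  -- `c₁` is outside `C`. Once `c′` is known, flip and toggle are undone.
  step-injective : ∀ {g} {V : Vec (Fin n) (suc g)} {c₁ c₂ x h₁ h₂ h′} →
    Step V c₁ x h₁ h′ → Step V c₂ x h₂ h′ → c₁ ≡ c₂ × h₁ ≡ h₂
  step-injective {V = V} {c₁} {c₂} {x} {h₁} {h₂} {h′} s₁ s₂ = c≡ , (begin
      h₁                              ≡⟨ toggle-involutive R v y h₁ ⟨
      toggle R v y (toggle R v y h₁)  ≡⟨ cong (toggle R v y) toggled≡ ⟩
      toggle R v y (toggle R v y h₂)  ≡⟨ toggle-involutive R v y h₂ ⟩
      h₂                              ∎)
    where
    open ≡-Reasoning
    module S₁ = Step s₁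
    module S₂ = Step s₂
    v = lookup V zero
    y = lookup V x

    moved : ∃[ i ] i ∈ R × entry h₁ i c ≡ y
    moved = inCol (full S₁.isReady x) (c∈C S₁.isReady)

    i = proj₁ moved
    i∈ = proj₁ (proj₂ moved)

    at₁ : entry h′ i c₁ ≡ v
    at₁ = step-moved s₁ i∈ (trans (toggle-in c i∈) (trans (cong (swap v y) (proj₂ (proj₂ moved))) (swap-right v y)))

    at₂ : ∃[ j ] j ∈ C × entry h₂ i j ≡ y
    at₂ = inRow (full S₂.isReady x) i∈

    same : ∀ j → entry h′ i j ≡ v → c₁ ≡ j
    same j eq = proj₁ (step-isLatin s₁) i c₁ j (trans at₁ (sym eq))

    c≡ : c₁ ≡ c₂
    c≡ with at₂
    ... | j , j∈ , eq with j ≟ c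
    ...   | yes refl = same c₂ (step-moved s₂ i∈ (trans (toggle-in c i∈) (trans (cong (swap v y) eq) (swap-right v y))))
    ...   | no j≢c = ⊥-elim (S₁.c′∉C (subst (_∈ C)
              (sym (same j (trans (step-other s₂ i∈ j∈ j≢c) (trans (cong (swap v y) eq) (swap-right v y))))) j∈))

    unflip : ∀ {c′ h} (s : Step V c′ x h h′) → flipPick c′ V h′ ≡ toggle R v y h
    unflip {c′} {h} s = trans (cong (flipPick c′ V) (Step.result s))
      (flipPick-involutive c′ V _ (toggled-isLatin s) (Step.isGood s))

    toggled≡ : toggle R v y h₁ ≡ toggle R v y h₂
    toggled≡ = trans (sym (unflip s₁)) (trans (cong (λ c′ → flipPick c′ V h′) c≡) (unflip s₂))

-- Which of the remaining values is exchanged with the first one, in each of g steps.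
Codes : ℕ → Set
Codes zero = ⊤
Codes (suc g) = Fin (suc (suc g)) × Codes g

-- The value that is never removed: it guarantees one surviving cell in the destroyed column.
final : {A : Set} {g : ℕ} → Vec A (suc g) → A
final {g = zero} (v ∷ []) = v
final {g = suc g} (_ ∷ V) = final V

-- The composite relabelling of the symbols of the subsquare by the successive toggles.
swaps : ∀ {g n} → Vec (Fin n) (suc g) → Codes g → Fin n → Fin n
swaps {zero} V _ q = q
swaps {suc g} (v ∷ V) (x , xs) q = swaps V xs (swap v (lookup (v ∷ V) x) q)

swaps-injective : ∀ {g n} (V : Vec (Fin n) (suc g)) xs → Inj (swaps V xs)
swaps-injective {zero} V _ eq = eq
swaps-injective {suc g} (v ∷ V) (x , xs) eq = swap-injective v _ (swaps-injective V xs eq)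

swaps-fixed : ∀ {g n} (V : Vec (Fin n) (suc g)) xs {q} → (∀ z → q ≢ lookup V z) → swaps V xs q ≡ q
swaps-fixed {zero} V _ q∉ = refl
swaps-fixed {suc g} (v ∷ V) (x , xs) q∉ =
  trans (cong (swaps V xs) (swap-other v _ (q∉ zero) (q∉ x))) (swaps-fixed V xs (q∉ ∘ suc))

swaps-natural : ∀ {g m n} (f : Fin m → Fin n) → Inj f → ∀ (W : Vec (Fin m) (suc g)) xs q →
  swaps (Vec.map f W) xs (f q) ≡ f (swaps W xs q)
swaps-natural {zero} f inj W _ q = refl
swaps-natural {suc g} f inj (w ∷ W) (x , xs) q =
  trans (cong (swaps (Vec.map f W) xs) (trans (cong (λ y → swap (f w) y (f q)) (lookup-map x f (w ∷ W))) (swap-natural f inj w _ q)))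
    (swaps-natural f inj W xs _)

swaps-final : ∀ {g n} (V : Vec (Fin n) (suc g)) xs {q} → swaps V xs q ≡ final V → ∃[ z ] q ≡ lookup V z
swaps-final {zero} (v ∷ []) _ eq = zero , eq
swaps-final {suc g} (v ∷ V) (x , xs) {q} eq with swaps-final V xs eq | swap-cases v (lookup (v ∷ V) x) q
... | z , e | inj₁ (q≡v , _) = zero , q≡v
... | z , e | inj₂ (inj₁ (q≡y , _)) = x , q≡y
... | z , e | inj₂ (inj₂ (_ , _ , s)) = suc z , trans (sym s) e

-- Chains of steps

module _ {k n : ℕ} (R : Subset k) (C : Subset n) (c : Fin n) where
  open Isolate R C c

  data Chain : ∀ {g} → Vec (Fin n) (suc g) → Vec (Fin n) g → Codes g → Matrix k n → Matrix k n → Set where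
    done : ∀ {V : Vec (Fin n) 1} {h} → Ready V h → Chain V [] tt h h
    link : ∀ {g v} {V : Vec (Fin n) (suc g)} {c′ cs x xs h h₁ h′} →
      Step (v ∷ V) c′ x h h₁ → Chain V cs xs h₁ h′ → Chain (v ∷ V) (c′ ∷ cs) (x , xs) h h′

  chain-exists : ∀ {g} (V : Vec (Fin n) (suc g)) (cs : Vec (Fin n) g) {h} → Ready V h → (∀ i → lookup cs i ∉ C) →
    ∃[ xs ] ∃[ h′ ] Chain V cs xs h h′
  chain-exists (v ∷ []) [] rdy _ = tt , _ , done rdy
  chain-exists (v ∷ V@(_ ∷ _)) (c′ ∷ cs) rdy cs∉ =
    let (x , h₁ , s) = step-exists rdy (cs∉ zero)
        (xs , h′ , chain) = chain-exists V cs (step-ready s) (cs∉ ∘ suc)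
    in (x , xs) , h′ , link s chain

  chain-isLatin : ∀ {g} {V : Vec (Fin n) (suc g)} {cs xs h h′} → Chain V cs xs h h′ → IsLatin h′
  chain-isLatin (done rdy) = latin rdy
  chain-isLatin (link _ chain) = chain-isLatin chain

  -- Outside column `c` each step only relabels. In column `c` this still holds for a cell that ends
  -- with the last value, because it contains a remaining value after every step and `step-kept`
  -- applies.
  chain-entry : ∀ {g} {V : Vec (Fin n) (suc g)} {cs xs h h′} → Chain V cs xs h h′ → ∀ {i j} → i ∈ R → j ∈ C →
    j ≢ c ⊎ swaps V xs (entry h i j) ≡ final V → entry h′ i j ≡ swaps V xs (entry h i j)
  chain-entry (done _) _ _ _ = refl
  chain-entry {V = v ∷ V} {xs = x , xs} {h} (link {h₁ = h₁} s chain) {i} {j} i∈ j∈ intact =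
    trans (chain-entry chain i∈ j∈ (rest intact)) (cong (swaps V xs) (first intact (j ≟ c)))
    where
    first : j ≢ c ⊎ swaps (v ∷ V) (x , xs) (entry h i j) ≡ final V → Dec (j ≡ c) →
      entry h₁ i j ≡ swap v (lookup (v ∷ V) x) (entry h i j)
    first _ (no j≢c) = step-other s i∈ j∈ j≢c
    first (inj₁ j≢c) (yes j≡c) = ⊥-elim (j≢c j≡c)
    first (inj₂ eq) (yes refl) = let (z , e) = swaps-final V xs eq in step-kept s i∈ z e
    rest : j ≢ c ⊎ swaps (v ∷ V) (x , xs) (entry h i j) ≡ final V → j ≢ c ⊎ swaps V xs (entry h₁ i j) ≡ final V
    rest (inj₁ j≢c) = inj₁ j≢c
    rest (inj₂ eq) = inj₂ (trans (cong (swaps V xs) (first (inj₂ eq) (j ≟ c))) eq)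

  -- The steps are undone from the last one backwards: the two tails determine a common `h₁`, which
  -- is the result of both first steps.
  chain-injective : ∀ {g} {V : Vec (Fin n) (suc g)} {cs₁ cs₂ xs h₁ h₂ h′} →
    Chain V cs₁ xs h₁ h′ → Chain V cs₂ xs h₂ h′ → cs₁ ≡ cs₂ × h₁ ≡ h₂
  chain-injective (done _) (done _) = refl , refl
  chain-injective (link s₁ chain₁) (link s₂ chain₂) with chain-injective chain₁ chain₂
  ... | refl , refl with step-injective s₁ s₂
  ...   | refl , refl = refl , refl

-- Coordinates of a subsquare

elements : ∀ {n} (P : Subset n) → Vec (Fin n) ∣ P ∣
elements [] = []
elements (true ∷ P) = zero ∷ Vec.map suc (elements P)
elements (false ∷ P) = Vec.map suc (elements P)

elements-∈ : ∀ {n} (P : Subset n) i → lookup (elements P) i ∈ P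
elements-∈ (true ∷ P) zero = here
elements-∈ (true ∷ P) (suc i) = subst (_∈ true ∷ P) (sym (lookup-map i suc (elements P))) (there (elements-∈ P i))
elements-∈ (false ∷ P) i = subst (_∈ false ∷ P) (sym (lookup-map i suc (elements P))) (there (elements-∈ P i))

elements-complete : ∀ {n} (P : Subset n) {x} → x ∈ P → ∃[ i ] lookup (elements P) i ≡ x
elements-complete (true ∷ P) here = zero , refl
elements-complete (true ∷ P) (there x∈) =
  let (i , eq) = elements-complete P x∈ in suc i , trans (lookup-map i suc (elements P)) (cong suc eq)
elements-complete (false ∷ P) (there x∈) =
  let (i , eq) = elements-complete P x∈ in i , trans (lookup-map i suc (elements P)) (cong suc eq)

elements-injective : ∀ {n} (P : Subset n) → Inj (lookup (elements P))
elements-injective (true ∷ P) {zero} {zero} eq = refl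
elements-injective (true ∷ P) {zero} {suc j} eq with trans eq (lookup-map j suc (elements P))
... | ()
elements-injective (true ∷ P) {suc i} {zero} eq with trans (sym eq) (lookup-map i suc (elements P))
... | ()
elements-injective (true ∷ P) {suc i} {suc j} eq = cong suc (elements-injective P (suc-injective
  (trans (sym (lookup-map i suc (elements P))) (trans eq (lookup-map j suc (elements P))))))
elements-injective (false ∷ P) {i} {j} eq = elements-injective P (suc-injective
  (trans (sym (lookup-map i suc (elements P))) (trans eq (lookup-map j suc (elements P)))))

-- An inductive family saves transports along ∣ P ∣ ≡ m. Since the order is canonical, the subset
-- and the vector determine each other and nothing about the order has to be guessed.
data Enumerates {n} (P : Subset n) : ∀ {m} → Vec (Fin n) m → Set where
  enumeration : Enumerates P (elements P)

enumerate : ∀ {n m} (P : Subset n) → ∣ P ∣ ≡ m → Σ[ ν ∈ Vec (Fin n) m ] Enumerates P ν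
enumerate P refl = elements P , enumeration

enum-∈ : ∀ {n m} {P : Subset n} {ν : Vec (Fin n) m} → Enumerates P ν → ∀ i → lookup ν i ∈ P
enum-∈ {P = P} enumeration = elements-∈ P

enum-complete : ∀ {n m} {P : Subset n} {ν : Vec (Fin n) m} → Enumerates P ν → ∀ {x} → x ∈ P → ∃[ i ] lookup ν i ≡ x
enum-complete {P = P} enumeration = elements-complete P

enum-injective : ∀ {n m} {P : Subset n} {ν : Vec (Fin n) m} → Enumerates P ν → Inj (lookup ν)
enum-injective {P = P} enumeration = elements-injective P

enum-unique : ∀ {n m} {P : Subset n} {ν ν′ : Vec (Fin n) m} → Enumerates P ν → Enumerates P ν′ → ν ≡ ν′
enum-unique enumeration enumeration = refl

enum-determines : ∀ {n m} {P P′ : Subset n} {ν : Vec (Fin n) m} → Enumerates P ν → Enumerates P′ ν → P ≡ P′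
enum-determines {P = P} {P′} E E′ = ⊆-antisym (sub E E′) (sub E′ E)
  where
  sub : ∀ {P P′} → Enumerates P _ → Enumerates P′ _ → ∀ {x} → x ∈ P → x ∈ P′
  sub E E′ x∈ = let (i , eq) = enum-complete E x∈ in subst (_∈ _) eq (enum-∈ E′ i)

symbols⁺ : ∀ {k n} (L : Matrix k n) {R C i j} → i ∈ R → j ∈ C → entry L i j ∈ symbols L R C
symbols⁺ L {R} {C} {i} {j} i∈ j∈ = lookup⇒[]= _ _ (trans (lookup∘tabulate _ (entry L i j))
  (dec-true (any? λ i′ → any? λ j′ → (i′ ∈? R) ×-dec (j′ ∈? C) ×-dec (entry L i′ j′ ≟ entry L i j)) (i , j , i∈ , j∈ , refl)))

record Square {k n} (m : ℕ) (L : Matrix k n) (R : Subset k) (C S : Subset n) : Set where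
  field
    latin : IsLatin L
    ρ : Vec (Fin k) m
    γ σ : Vec (Fin n) m
    ρ-enum : Enumerates R ρ
    γ-enum : Enumerates C γ
    σ-enum : Enumerates S σ
    M : Matrix m m
    L≡M : ∀ p q → entry L (lookup ρ p) (lookup γ q) ≡ lookup σ (entry M p q)

  M-latin : IsLatin M
  M-latin = (λ p q q′ eq → enum-injective γ-enum (proj₁ latin _ _ _ (trans (L≡M p q) (trans (cong (lookup σ) eq) (sym (L≡M p q′))))))
          , (λ q p p′ eq → enum-injective ρ-enum (proj₂ latin _ _ _ (trans (L≡M p q) (trans (cong (lookup σ) eq) (sym (L≡M p′ q))))))

square : ∀ {k n m} {L : Matrix k n} {R C} → IsLatin L → IsSubsquare m L (R , C) → Square m L R C (symbols L R C)
square {L = L} {R} {C} latin (∣R∣ , ∣C∣ , ∣S∣) =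
  let (ρ , ρ-enum) = enumerate R ∣R∣
      (γ , γ-enum) = enumerate C ∣C∣
      (σ , σ-enum) = enumerate (symbols L R C) ∣S∣
      label = λ p q → enum-complete σ-enum (symbols⁺ L (enum-∈ ρ-enum p) (enum-∈ γ-enum q))
  in record
    { latin = latin ; ρ = ρ ; γ = γ ; σ = σ ; ρ-enum = ρ-enum ; γ-enum = γ-enum ; σ-enum = σ-enum
    ; M = matrix (λ p q → proj₁ (label p q))
    ; L≡M = λ p q → trans (sym (proj₂ (label p q))) (cong (lookup σ) (sym (entry-matrix _ p q))) }

rows-surjective : ∀ {m} (M : Matrix m m) → IsLatin M → ∀ p s → ∃[ q ] entry M p q ≡ s
rows-surjective M latin p = injective⇒surjective (entry M p) (λ {x} {y} → proj₁ latin p x y)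

cols-surjective : ∀ {m} (M : Matrix m m) → IsLatin M → ∀ q s → ∃[ p ] entry M p q ≡ s
cols-surjective M latin q = injective⇒surjective (λ p → entry M p q) (λ {x} {y} → proj₂ latin q x y)

-- Replacing a subsquare by another Latin square on the same symbols

module _ {k n m : ℕ} (ρ : Vec (Fin k) m) (γ σ : Vec (Fin n) m) where

  private
    cell : Matrix m m → Matrix k n → ∀ i j → Dec (∃[ p ] lookup ρ p ≡ i) → Dec (∃[ q ] lookup γ q ≡ j) → Fin n
    cell M L i j (yes (p , _)) (yes (q , _)) = lookup σ (entry M p q)
    cell M L i j _ _ = entry L i j

    row? : ∀ i → Dec (∃[ p ] lookup ρ p ≡ i)
    row? i = any? λ p → lookup ρ p ≟ i

    col? : ∀ j → Dec (∃[ q ] lookup γ q ≡ j)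
    col? j = any? λ q → lookup γ q ≟ j

  opaque
    replace : Matrix m m → Matrix k n → Matrix k n
    replace M L = matrix λ i j → cell M L i j (row? i) (col? j)

  module _ {M : Matrix m m} {L : Matrix k n} where
    opaque
      unfolding replace

      replace-in : Inj (lookup ρ) → Inj (lookup γ) → ∀ p q → entry (replace M L) (lookup ρ p) (lookup γ q) ≡ lookup σ (entry M p q)
      replace-in ρ-inj γ-inj p q = trans (entry-matrix _ _ _) (go (row? (lookup ρ p)) (col? (lookup γ q)))
        where
        go : ∀ r? c? → cell M L (lookup ρ p) (lookup γ q) r? c? ≡ lookup σ (entry M p q)
        go (yes (p′ , e)) (yes (q′ , e′)) = cong₂ (λ p q → lookup σ (entry M p q)) (ρ-inj e) (γ-inj e′)
        go (yes _) (no ¬c) = contradiction (q , refl) ¬c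
        go (no ¬r) _ = contradiction (p , refl) ¬r

      replace-row : ∀ {i} j → (∀ p → lookup ρ p ≢ i) → entry (replace M L) i j ≡ entry L i j
      replace-row {i} j i∉ = trans (entry-matrix _ _ _) (go (row? i))
        where
        go : ∀ r? → cell M L i j r? (col? j) ≡ entry L i j
        go (yes (p , e)) = contradiction e (i∉ p)
        go (no _) = refl

      replace-col : ∀ i {j} → (∀ q → lookup γ q ≢ j) → entry (replace M L) i j ≡ entry L i j
      replace-col i {j} j∉ = trans (entry-matrix _ _ _) (go (row? i) (col? j))
        where
        go : ∀ r? c? → cell M L i j r? c? ≡ entry L i j
        go _ (yes (q , e)) = contradiction e (j∉ q)
        go (yes _) (no _) = refl
        go (no _) (no _) = refl

  module _ (ρ-inj : Inj (lookup ρ)) (γ-inj : Inj (lookup γ)) where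

    -- Recovers `L` from its version with a cyclic subsquare once `M` is known.
    replace-undo : ∀ {M N L} → (∀ p q → entry L (lookup ρ p) (lookup γ q) ≡ lookup σ (entry M p q)) →
      replace M (replace N L) ≡ L
    replace-undo {M} {N} {L} L≡M = matrix-ext λ i j → go i j (row? i) (col? j)
      where
      go : ∀ i j → Dec (∃[ p ] lookup ρ p ≡ i) → Dec (∃[ q ] lookup γ q ≡ j) → entry (replace M (replace N L)) i j ≡ entry L i j
      go _ _ (yes (p , refl)) (yes (q , refl)) = trans (replace-in ρ-inj γ-inj p q) (sym (L≡M p q))
      go i j (no ¬r) _ = trans (replace-row j (λ p e → ¬r (p , e))) (replace-row j (λ p e → ¬r (p , e)))
      go i j (yes _) (no ¬c) = trans (replace-col i (λ q e → ¬c (q , e))) (replace-col i (λ q e → ¬c (q , e)))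

    -- Each row of the subsquare has all of its symbols inside, so they do not occur in that row
    -- outside it; the same holds for columns. Hence a new square on these symbols meets no clash.
    replace-isLatin : ∀ {M N L} → Inj (lookup σ) → IsLatin L → IsLatin M → IsLatin N →
      (∀ p q → entry L (lookup ρ p) (lookup γ q) ≡ lookup σ (entry M p q)) → IsLatin (replace N L)
    replace-isLatin {M} {N} {L} σ-inj latin M-latin N-latin L≡M = rows , cols
      where
      h = replace N L

      not-in-row : ∀ p {j} s → (∀ q → lookup γ q ≢ j) → entry L (lookup ρ p) j ≢ lookup σ s
      not-in-row p s j∉ eq = let (q , e) = rows-surjective M M-latin p s in
        j∉ q (proj₁ latin (lookup ρ p) _ _ (trans (L≡M p q) (trans (cong (lookup σ) e) (sym eq))))

      not-in-col : ∀ q {i} s → (∀ p → lookup ρ p ≢ i) → entry L i (lookup γ q) ≢ lookup σ s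
      not-in-col q s i∉ eq = let (p , e) = cols-surjective M M-latin q s in
        i∉ p (proj₂ latin (lookup γ q) _ _ (trans (L≡M p q) (trans (cong (lookup σ) e) (sym eq))))

      inside : ∀ p q → entry h (lookup ρ p) (lookup γ q) ≡ lookup σ (entry N p q)
      inside = replace-in ρ-inj γ-inj

      rows : ∀ i j j′ → entry h i j ≡ entry h i j′ → j ≡ j′
      rows i j j′ eq with row? i
      ... | no ¬r = proj₁ latin i j j′ (trans (sym (replace-row j (λ p e → ¬r (p , e)))) (trans eq (replace-row j′ (λ p e → ¬r (p , e)))))
      ... | yes (p , refl) with col? j | col? j′
      ...   | yes (q , refl) | yes (q′ , refl) = cong (lookup γ) (proj₁ N-latin p q q′
                (σ-inj (trans (sym (inside p q)) (trans eq (inside p q′)))))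
      ...   | no ¬c | no ¬c′ = proj₁ latin _ j j′ (trans (sym (replace-col _ (λ q e → ¬c (q , e)))) (trans eq (replace-col _ (λ q e → ¬c′ (q , e)))))
      ...   | yes (q , refl) | no ¬c′ = ⊥-elim (not-in-row p (entry N p q) (λ q e → ¬c′ (q , e))
                (trans (sym (replace-col _ (λ q e → ¬c′ (q , e)))) (trans (sym eq) (inside p q))))
      ...   | no ¬c | yes (q , refl) = ⊥-elim (not-in-row p (entry N p q) (λ q e → ¬c (q , e))
                (trans (sym (replace-col _ (λ q e → ¬c (q , e)))) (trans eq (inside p q))))

      cols : ∀ j i i′ → entry h i j ≡ entry h i′ j → i ≡ i′
      cols j i i′ eq with col? j
      ... | no ¬c = proj₂ latin j i i′ (trans (sym (replace-col i (λ q e → ¬c (q , e)))) (trans eq (replace-col i′ (λ q e → ¬c (q , e)))))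
      ... | yes (q , refl) with row? i | row? i′
      ...   | yes (p , refl) | yes (p′ , refl) = cong (lookup ρ) (proj₂ N-latin q p p′
                (σ-inj (trans (sym (inside p q)) (trans eq (inside p′ q)))))
      ...   | no ¬r | no ¬r′ = proj₂ latin _ i i′ (trans (sym (replace-row _ (λ p e → ¬r (p , e)))) (trans eq (replace-row _ (λ p e → ¬r′ (p , e)))))
      ...   | yes (p , refl) | no ¬r′ = ⊥-elim (not-in-col q (entry N p q) (λ p e → ¬r′ (p , e))
                (trans (sym (replace-row _ (λ p e → ¬r′ (p , e)))) (trans (sym eq) (inside p q))))
      ...   | no ¬r | yes (p , refl) = ⊥-elim (not-in-col q (entry N p q) (λ p e → ¬r (p , e))
                (trans (sym (replace-row _ (λ p e → ¬r (p , e)))) (trans eq (inside p q))))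

-- Columns and symbols are interchanged.
module _ {k n : ℕ} where

  private
    columnOf? : ∀ (h : Matrix k n) i s → Dec (∃[ j ] entry h i j ≡ s)
    columnOf? h i s = any? λ j → entry h i j ≟ s

    columnOf : ∀ {h : Matrix k n} {i s} → Dec (∃[ j ] entry h i j ≡ s) → Fin n
    columnOf (yes (j , _)) = j
    -- Never reached for a Latin rectangle, whose rows contain every symbol.
    columnOf {s = s} (no _) = s

  opaque
    conj : Matrix k n → Matrix k n
    conj h = matrix λ i s → columnOf {h} (columnOf? h i s)

    conj-right : ∀ h → IsLatin h → ∀ i s → entry h i (entry (conj h) i s) ≡ s
    conj-right h latin i s = trans (cong (entry h i) (entry-matrix _ i s)) (go (columnOf? h i s))
      where
      go : (d : Dec (∃[ j ] entry h i j ≡ s)) → entry h i (columnOf {h} d) ≡ s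
      go (yes (_ , eq)) = eq
      go (no ¬j) = contradiction (injective⇒surjective (entry h i) (λ {x} {y} → proj₁ latin i x y) s) ¬j

  conj-left : ∀ h → IsLatin h → ∀ i j → entry (conj h) i (entry h i j) ≡ j
  conj-left h latin i j = proj₁ latin i _ _ (conj-right h latin i _)

  conj-isLatin : ∀ h → IsLatin h → IsLatin (conj h)
  conj-isLatin h latin =
    (λ i s s′ eq → trans (sym (conj-right h latin i s)) (trans (cong (entry h i) eq) (conj-right h latin i s′))) ,
    (λ s i i′ eq → proj₂ latin (entry (conj h) i s) i i′
      (trans (conj-right h latin i s) (trans (sym (conj-right h latin i′ s)) (cong (entry h i′) (sym eq)))))

  conj-injective : ∀ h h′ → IsLatin h → IsLatin h′ → conj h ≡ conj h′ → h ≡ h′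
  conj-injective h h′ latin latin′ eq = matrix-ext λ i j → proj₁ (conj-isLatin h′ latin′) i _ _
    (trans (cong (λ f → entry f i (entry h i j)) (sym eq)) (trans (conj-left h latin i j) (sym (conj-left h′ latin′ i j))))

-- Lists of members, of non-members and of vectors

members : ∀ {n} → Subset n → List (Fin n)
members P = List.tabulate (lookup (elements P))

length-members : ∀ {n} (P : Subset n) → length (members P) ≡ ∣ P ∣
length-members P = Listₚ.length-tabulate _

members-unique : ∀ {n} (P : Subset n) → Unique (members P)
members-unique P = Unique.tabulate⁺ (elements-injective P)

∈-members⁺ : ∀ {n} {P : Subset n} {x} → x ∈ P → x ∈ˡ members P
∈-members⁺ {P = P} x∈ = let (i , eq) = elements-complete P x∈ in subst (_∈ˡ members P) eq (∈-tabulate⁺ i)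

∈-members⁻ : ∀ {n} {P : Subset n} {x} → x ∈ˡ members P → x ∈ P
∈-members⁻ {P = P} x∈ = let (i , eq) = ∈-tabulate⁻ x∈ in subst (_∈ P) (sym eq) (elements-∈ P i)

outside : ∀ {n} → Subset n → List (Fin n)
outside P = members (∁ P)

∈-outside : ∀ {n} {P : Subset n} {x} → x ∈ˡ outside P → x ∉ P
∈-outside = x∈∁p⇒x∉p ∘ ∈-members⁻

length-outside : ∀ {n} (P : Subset n) → length (outside P) ≡ n ∸ ∣ P ∣
length-outside P = trans (length-members (∁ P)) (∣∁p∣≡n∸∣p∣ P)

vectors-unique : ∀ {A : Set} {xs : List A} n → Unique xs → Unique (vectors xs n)
vectors-unique zero u = All.[] AllPairs.∷ AllPairs.[]
vectors-unique (suc n) u = Unique.cartesianProductWith⁺ _∷_ (λ { refl → refl , refl }) u (vectors-unique n u)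

∈-vectors⁻ : ∀ {A : Set} {xs : List A} {n} {v : Vec A n} → v ∈ˡ vectors xs n → ∀ i → lookup v i ∈ˡ xs
∈-vectors⁻ {xs = xs} {suc n} v∈ i with ∈-cartesianProductWith⁻ _∷_ xs (vectors xs n) v∈
... | a , w , a∈ , w∈ , refl with i
...   | zero = a∈
...   | suc i = ∈-vectors⁻ w∈ i

length-cartesianProductWith : ∀ {A B D : Set} (f : A → B → D) xs ys → length (List.cartesianProductWith f xs ys) ≡ length xs * length ys
length-cartesianProductWith f [] ys = refl
length-cartesianProductWith f (x ∷ xs) ys = trans (Listₚ.length-++ (List.map (f x) ys))
  (cong₂ _+_ (Listₚ.length-map (f x) ys) (length-cartesianProductWith f xs ys))

length-vectors : ∀ {A : Set} (xs : List A) n → length (vectors xs n) ≡ length xs ^ n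
length-vectors xs zero = refl
length-vectors xs (suc n) = trans (length-cartesianProductWith _∷_ xs (vectors xs n)) (cong (length xs *_) (length-vectors xs n))

-- Counting

module _ {A B : Set} where

  pairs : List A → (A → List B) → List (A × B)
  pairs [] F = []
  pairs (x ∷ xs) F = map (x ,_) (F x) ++ pairs xs F

  ∈-pairs⁻ : ∀ xs (F : A → List B) {a b} → (a , b) ∈ˡ pairs xs F → a ∈ˡ xs × b ∈ˡ F a
  ∈-pairs⁻ (x ∷ xs) F ab∈ with ∈-++⁻ (map (x ,_) (F x)) ab∈
  ... | inj₂ ab∈′ = let (a∈ , b∈) = ∈-pairs⁻ xs F ab∈′ in there a∈ , b∈
  ... | inj₁ ab∈′ with ∈-map⁻ (x ,_) ab∈′
  ...   | _ , b∈ , refl = here refl , b∈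

  pairs-unique : ∀ xs (F : A → List B) → Unique xs → (∀ a → Unique (F a)) → Unique (pairs xs F)
  pairs-unique [] F u uF = AllPairs.[]
  pairs-unique (x ∷ xs) F (x∉ AllPairs.∷ u) uF = Unique.++⁺ (Unique.map⁺ (λ { refl → refl }) (uF x)) (pairs-unique xs F u uF) disjoint
    where
    disjoint : ∀ {ab} → ab ∈ˡ map (x ,_) (F x) × ab ∈ˡ pairs xs F → ⊥
    disjoint (∈₁ , ∈₂) with ∈-map⁻ (x ,_) ∈₁
    ... | _ , _ , refl = All.lookup x∉ (proj₁ (∈-pairs⁻ xs F ∈₂)) refl

  length-pairs : ∀ xs (F : A → List B) → length (pairs xs F) ≡ sum (map (length ∘ F) xs)
  length-pairs [] F = refl
  length-pairs (x ∷ xs) F = trans (Listₚ.length-++ (map (x ,_) (F x)))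
    (cong₂ _+_ (Listₚ.length-map (x ,_) (F x)) (length-pairs xs F))

  length-pairs-const : ∀ xs (F : A → List B) {d} → (∀ {a} → a ∈ˡ xs → length (F a) ≡ d) → length (pairs xs F) ≡ length xs * d
  length-pairs-const [] F eq = refl
  length-pairs-const (x ∷ xs) F eq = trans (Listₚ.length-++ (map (x ,_) (F x)))
    (cong₂ _+_ (trans (Listₚ.length-map (x ,_) (F x)) (eq (here refl))) (length-pairs-const xs F (eq ∘ there)))

length-allFin : ∀ n → length (allFin n) ≡ n
length-allFin n = Listₚ.length-tabulate id

map-distinct : ∀ {A B : Set} {g} (f : A → B) → Inj f → (W : Vec A g) → Inj (lookup W) → Inj (lookup (Vec.map f W))
map-distinct f f-inj W W-inj {x} {y} eq = W-inj (f-inj (trans (sym (lookup-map x f W)) (trans eq (lookup-map y f W))))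

allCodes : ∀ g → List (Codes g)
allCodes zero = tt ∷ []
allCodes (suc g) = cartesianProduct (allFin (suc (suc g))) (allCodes g)

∈-allCodes : ∀ {g} (xs : Codes g) → xs ∈ˡ allCodes g
∈-allCodes {zero} tt = here refl
∈-allCodes {suc g} (x , xs) = ∈-cartesianProduct⁺ (∈-allFin x) (∈-allCodes xs)

subsquares : ∀ {k n} m → Matrix k n → List (Subset k × Subset n)
subsquares {k} {n} m L = filter (isSubsquare? m L) (cartesianProduct (subsets k) (subsets n))

subsets-unique : ∀ n → Unique (subsets n)
subsets-unique n = vectors-unique n (((λ ()) All.∷ All.[]) AllPairs.∷ (All.[] AllPairs.∷ AllPairs.[]))

subsquares-unique : ∀ {k n} m (L : Matrix k n) → Unique (subsquares m L)
subsquares-unique {k} {n} m L = Unique.filter⁺ (isSubsquare? m L) (Unique.cartesianProduct⁺ (subsets-unique k) (subsets-unique n))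

latinRectangles-unique : ∀ k n → Unique (latinRectangles k n)
latinRectangles-unique k n = Unique.filter⁺ isLatin? (vectors-unique k (vectors-unique n (Unique.allFin⁺ n)))

∈-latinRectangles⁻ : ∀ {k n} {L : Matrix k n} → L ∈ˡ latinRectangles k n → IsLatin L
∈-latinRectangles⁻ {k} {n} L∈ = proj₂ (∈-filter⁻ isLatin? {xs = matrices k n} L∈)

-- The set to be estimated: its size over the number of Latin rectangles is the expectation.
located : ∀ k n m → List (Matrix k n × (Subset k × Subset n))
located k n m = pairs (latinRectangles k n) (subsquares m)

located-unique : ∀ k n m → Unique (located k n m)
located-unique k n m = pairs-unique _ _ (latinRectangles-unique k n) (subsquares-unique m)

∈-located⁻ : ∀ {k n m} {L : Matrix k n} {R C} → (L , R , C) ∈ˡ located k n m → IsLatin L × IsSubsquare m L (R , C)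
∈-located⁻ {k} {n} {m} {L} x∈ = let (L∈ , RC∈) = ∈-pairs⁻ (latinRectangles k n) (subsquares m) x∈ in
  ∈-latinRectangles⁻ L∈ , proj₂ (∈-filter⁻ (isSubsquare? m L) {xs = cartesianProduct (subsets k) (subsets n)} RC∈)

-- Subsquares of bounded order

module Bounded (m′ : ℕ) where

  m : ℕ
  m = 4 + m′

  pattern one = suc zero
  pattern two = suc (suc zero)
  pattern three = suc (suc (suc zero))

  opaque
    Cyc : Matrix m m
    Cyc = cyclic m m

    Cyc-latin : IsLatin Cyc
    Cyc-latin = cyclic-isLatin m m ℕ.≤-refl

    toℕ-Cyc : ∀ i j → toℕ (entry Cyc i j) ≡ (toℕ i + toℕ j) % m
    toℕ-Cyc i j = trans
      (cong toℕ (trans (cong (λ row → lookup row j) (lookup∘tabulate (λ i → tabulate (sum′ i)) i)) (lookup∘tabulate (sum′ i) j)))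
      (toℕ-fromℕ< _)
      where
      sum′ : Fin m → Fin m → Fin m
      sum′ i j = (toℕ i + toℕ j) mod m

  _⊕_ : Fin m → Fin m → Fin m
  i ⊕ j = entry Cyc i j

  -- Residues modulo m are counted from the symbol `τ` that the second chain destroys, so that the
  -- other symbols are the points 1 to m - 1.
  module Points (τ : Fin m) where

    opaque
      point : ℕ → Fin m
      point d = (toℕ τ + d) mod m

      toℕ-point : ∀ d → toℕ (point d) ≡ (toℕ τ + d) % m
      toℕ-point d = toℕ-fromℕ< _

    point-⊕ : ∀ d j → point d ⊕ j ≡ point (toℕ j + d)
    point-⊕ d j = toℕ-injective (begin
      toℕ (point d ⊕ j)                             ≡⟨ toℕ-Cyc (point d) j ⟩
      (toℕ (point d) + toℕ j) % m                   ≡⟨ cong (λ a → (a + toℕ j) % m) (toℕ-point d) ⟩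
      ((toℕ τ + d) % m + toℕ j) % m                 ≡⟨ %-distribˡ-+ ((toℕ τ + d) % m) (toℕ j) m ⟩
      ((toℕ τ + d) % m % m + toℕ j % m) % m         ≡⟨ cong (λ a → (a + toℕ j % m) % m) (m%n%n≡m%n (toℕ τ + d) m) ⟩
      ((toℕ τ + d) % m + toℕ j % m) % m             ≡⟨ %-distribˡ-+ (toℕ τ + d) (toℕ j) m ⟨
      (toℕ τ + d + toℕ j) % m                       ≡⟨ cong (_% m) (trans (ℕ.+-assoc (toℕ τ) d (toℕ j)) (cong (toℕ τ +_) (ℕ.+-comm d (toℕ j)))) ⟩
      (toℕ τ + (toℕ j + d)) % m                     ≡⟨ toℕ-point (toℕ j + d) ⟨
      toℕ (point (toℕ j + d))                       ∎)
      where open ≡-Reasoning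

    point-zero : point 0 ≡ τ
    point-zero = toℕ-injective (trans (toℕ-point 0) (trans (cong (_% m) (ℕ.+-identityʳ (toℕ τ))) (m<n⇒m%n≡m (toℕ<n τ))))

    point-period : ∀ d → point (d + m) ≡ point d
    point-period d = toℕ-injective (trans (toℕ-point (d + m)) (trans
      (trans (cong (_% m) (sym (ℕ.+-assoc (toℕ τ) d m))) ([m+n]%n≡m%n (toℕ τ + d) m)) (sym (toℕ-point d))))

    τ⊕ : ∀ j → τ ⊕ j ≡ point (toℕ j)
    τ⊕ j = trans (cong (_⊕ j) (sym point-zero)) (trans (point-⊕ 0 j) (cong point (ℕ.+-identityʳ (toℕ j))))

    opaque
      point-surjective : ∀ i → ∃[ j ] point (toℕ {m} j) ≡ i
      point-surjective i = let (j , eq) = rows-surjective Cyc Cyc-latin τ i in j , trans (sym (τ⊕ j)) eq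

    point-≢ : ∀ (j : Fin m) → j ≢ zero → point (toℕ j) ≢ τ
    point-≢ j j≢ eq = j≢ (proj₁ Cyc-latin τ j zero (trans (τ⊕ j) (trans eq (trans (sym point-zero) (sym (τ⊕ zero))))))

    point-suc-≢ : ∀ d → suc d < m → point (suc d) ≢ τ
    point-suc-≢ d d< = subst (λ e → point e ≢ τ) (toℕ-fromℕ< d<) (point-≢ (fromℕ< d<) nz)
      where
      nz : fromℕ< d< ≢ zero
      nz ()

  -- What is left of a cyclic subsquare: f is the conjugate array, column zero and symbol τ have been
  -- destroyed, except for the symbol υ of column zero and for column l of the symbol τ.
  record Remnant {k n} (τ υ l : Fin m) (f : Matrix k n) (ρ : Fin m → Fin k) (γ σ : Fin m → Fin n) : Set where
    field
      generic : ∀ i j → j ≢ zero → i ⊕ j ≢ τ → entry f (ρ i) (σ (i ⊕ j)) ≡ γ j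
      column₀ : ∀ i → i ⊕ zero ≡ υ → entry f (ρ i) (σ υ) ≡ γ zero
      symbolτ : ∀ i → i ⊕ l ≡ τ → entry f (ρ i) (σ τ) ≡ γ l

  -- The columns 1 and 2 link the symbol t to row t − 1 and that row to the symbol t + 1, so that
  -- all rows are reached from the symbol τ + 1 without using τ.
  module _ {k n} {τ υ l : Fin m} {f : Matrix k n} (latin : IsLatin f) (υ≢τ : υ ≢ τ) (l≢0 : l ≢ zero)
    {ρ ρ~ : Fin m → Fin k} {γ γ~ σ σ~ : Fin m → Fin n}
    (T : Remnant τ υ l f ρ γ σ) (T~ : Remnant τ υ l f ρ~ γ~ σ~)
    (γ₁ : γ one ≡ γ~ one) (γ₂ : γ two ≡ γ~ two) (σ₁ : σ (Points.point τ 1) ≡ σ~ (Points.point τ 1)) where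

    open Points τ
    private
      module T = Remnant T
      module T~ = Remnant T~

      row-from : ∀ i j → j ≢ zero → i ⊕ j ≢ τ → γ j ≡ γ~ j → σ (i ⊕ j) ≡ σ~ (i ⊕ j) → ρ i ≡ ρ~ i
      row-from i j j≢ t≢ γ≡ σ≡ = proj₂ latin (σ (i ⊕ j)) (ρ i) (ρ~ i) (trans (T.generic i j j≢ t≢)
        (trans γ≡ (trans (sym (T~.generic i j j≢ t≢)) (cong (entry f (ρ~ i)) (sym σ≡)))))

      symbol-from : ∀ i j → j ≢ zero → i ⊕ j ≢ τ → γ j ≡ γ~ j → ρ i ≡ ρ~ i → σ (i ⊕ j) ≡ σ~ (i ⊕ j)
      symbol-from i j j≢ t≢ γ≡ ρ≡ = proj₁ latin (ρ i) _ _ (trans (T.generic i j j≢ t≢)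
        (trans γ≡ (trans (sym (T~.generic i j j≢ t≢)) (cong (λ r → entry f r (σ~ (i ⊕ j))) (sym ρ≡)))))

      walk-row : ∀ d → suc d < m → σ (point (suc d)) ≡ σ~ (point (suc d)) → ρ (point d) ≡ ρ~ (point d)
      walk-row d d< σ≡ = row-from (point d) one (λ ()) (subst (_≢ τ) (sym (point-⊕ d one)) (point-suc-≢ d d<)) γ₁
        (subst (λ t → σ t ≡ σ~ t) (sym (point-⊕ d one)) σ≡)

      walk : ∀ d → suc d < m → σ (point (suc d)) ≡ σ~ (point (suc d))
      walk zero _ = σ₁
      walk (suc d) d< = subst (λ t → σ t ≡ σ~ t) (point-⊕ d two)
        (symbol-from (point d) two (λ ()) (subst (_≢ τ) (sym (point-⊕ d two)) (point-suc-≢ (suc d) d<)) γ₂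
          (walk-row d (ℕ.<-trans (ℕ.n<1+n _) d<) (walk d (ℕ.<-trans (ℕ.n<1+n _) d<))))

      last-point : point (2 + (3 + m′)) ≡ point 1
      last-point = point-period 1

    rows≡ : ∀ i → ρ i ≡ ρ~ i
    rows≡ i with point-surjective i
    ... | j , refl with ℕ.m≤n⇒m<n∨m≡n (toℕ<n j)
    ...   | inj₁ d< = walk-row (toℕ j) d< (walk (toℕ j) d<)
    -- In column 1 the last row τ + (m - 1) holds the destroyed symbol τ. It is reached through
    -- column 2 instead, where it holds τ + (m + 1), that is, τ + 1.
    ...   | inj₂ d≡ = row-from (point (toℕ j)) two (λ ())
              (subst (_≢ τ) (sym t≡) (point-suc-≢ 0 (s≤s (s≤s z≤n)))) γ₂ (subst (λ t → σ t ≡ σ~ t) (sym t≡) σ₁)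
      where
      t≡ : point (toℕ j) ⊕ two ≡ point 1
      t≡ = trans (point-⊕ (toℕ j) two) (trans (cong (λ e → point (2 + e)) (ℕ.suc-injective d≡)) last-point)

    private
      symbol≢τ : ∀ t → t ≢ τ → σ t ≡ σ~ t
      symbol≢τ t t≢ with point-surjective t
      ... | zero , refl = contradiction point-zero t≢
      ... | suc j , refl = walk (toℕ j) (s≤s (toℕ<n j))

    -- Column j is read off in the row where it holds `υ`. For j ≠ 0 this cell is generic because
    -- `υ` differs from `τ`; for j = 0 it is the surviving cell.
    columns≡ : ∀ j → γ j ≡ γ~ j
    columns≡ j with cols-surjective Cyc Cyc-latin j υ | j ≟ zero
    ... | i , eq | yes refl = trans (sym (T.column₀ i eq)) (trans (cong₂ (entry f) (rows≡ i) (symbol≢τ υ υ≢τ)) (T~.column₀ i eq))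
    ... | i , eq | no j≢ = trans (sym (T.generic i j j≢ t≢)) (trans (cong₂ (entry f) (rows≡ i) (symbol≢τ (i ⊕ j) t≢)) (T~.generic i j j≢ t≢))
      where
      t≢ : i ⊕ j ≢ τ
      t≢ = υ≢τ ∘ trans (sym eq)

    -- The walk has reached all symbols except `τ`, which is read off at its surviving cell in
    -- column `l`.
    symbols≡ : ∀ t → σ t ≡ σ~ t
    symbols≡ t with t ≟ τ
    ... | no t≢ = symbol≢τ t t≢
    ... | yes refl = let (i , eq) = cols-surjective Cyc Cyc-latin l τ in
      proj₁ latin (ρ i) _ _ (trans (T.symbolτ i eq) (trans (columns≡ l) (trans (sym (T~.symbolτ i eq)) (cong (λ r → entry f r (σ~ τ)) (sym (rows≡ i))))))

  W₁ : Vec (Fin m) 4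
  W₁ = zero ∷ one ∷ two ∷ three ∷ []

  -- Column 0 is destroyed by the first chain and cannot serve as a value in the second. Three
  -- further columns are used, which is possible for m ≥ 4.
  W₂ : Vec (Fin m) 3
  W₂ = one ∷ two ∷ three ∷ []

  W₁-inj : Inj (lookup W₁)
  W₁-inj {x} {y} eq = toℕ-injective (trans (sym (toℕ-W₁ x)) (trans (cong toℕ eq) (toℕ-W₁ y)))
    where
    toℕ-W₁ : ∀ x → toℕ (lookup W₁ x) ≡ toℕ x
    toℕ-W₁ zero = refl
    toℕ-W₁ one = refl
    toℕ-W₁ two = refl
    toℕ-W₁ three = refl

  W₂-inj : Inj (lookup W₂)
  W₂-inj {x} {y} eq = toℕ-injective (ℕ.suc-injective (trans (sym (toℕ-W₂ x)) (trans (cong toℕ eq) (toℕ-W₂ y))))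
    where
    toℕ-W₂ : ∀ x → toℕ (lookup W₂ x) ≡ suc (toℕ x)
    toℕ-W₂ zero = refl
    toℕ-W₂ one = refl
    toℕ-W₂ two = refl

  swaps⁻¹ : ∀ {g} (W : Vec (Fin m) (suc g)) xs t → ∃[ u ] swaps W xs u ≡ t
  swaps⁻¹ W xs = injective⇒surjective (swaps W xs) (swaps-injective W xs)

  -- After the relabelling `τ` becomes 0, the symbol on which the second chain works, and `υ`
  -- becomes 3, the final value of `W₁`, which survives in column 0.
  τ υ : Codes 3 → Fin m
  τ xs = proj₁ (swaps⁻¹ W₁ xs zero)
  υ xs = proj₁ (swaps⁻¹ W₁ xs three)

  -- The column that becomes 3, the final value of `W₂`, so that its cell with symbol `τ` survives
  -- the second chain.
  l : Codes 2 → Fin m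
  l xs = proj₁ (swaps⁻¹ W₂ xs three)

  W₂-zero : ∀ xs → swaps W₂ xs zero ≡ zero
  W₂-zero xs = swaps-fixed W₂ xs λ where
    zero ()
    one ()
    two ()

  module _ {k n : ℕ} where

    -- Five choices of columns and symbols in a source are weighed against three guessed lines and
    -- data that depend on m only in a target.
    Source Target : Set
    Source = (Matrix k n × (Subset k × Subset n)) × (Vec (Fin n) 3 × Vec (Fin n) 2)
    Target = Matrix k n × (Vec (Fin n) 3 × (Matrix m m × (Codes 3 × Codes 2)))

    record Trace (s : Source) (t : Target) : Set where
      private
        L = proj₁ (proj₁ s)
        R = proj₁ (proj₂ (proj₁ s))
        C = proj₂ (proj₂ (proj₁ s))
        f = proj₁ t
        xs = proj₁ (proj₂ (proj₂ (proj₂ t)))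
        ys = proj₂ (proj₂ (proj₂ (proj₂ t)))
      field
        S : Subset n
        sq : Square m L R C S
      open Square sq public
      field
        h : Matrix k n
        chain₁ : Chain R C (lookup γ zero) (Vec.map (lookup σ) W₁) (proj₁ (proj₂ s)) xs (replace ρ γ σ Cyc L) h
        chain₂ : Chain R S (lookup σ zero) (Vec.map (lookup γ) W₂) (proj₂ (proj₂ s)) ys (conj h) f
        M≡ : proj₁ (proj₂ (proj₂ t)) ≡ M
        -- The lines from which the walk starts: columns 1 and 2 and the symbol τ + 1, relabelled as
        -- in the remnant.
        guess : proj₁ (proj₂ t) ≡ lookup γ (swaps W₂ ys one) ∷ lookup γ (swaps W₂ ys two)
                  ∷ lookup σ (swaps W₁ xs (Points.point (τ xs) 1)) ∷ []

    module Existence {L : Matrix k n} {R C S} (sq : Square m L R C S) where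
      open Square sq

      ρ-inj = λ {x} {y} → enum-injective ρ-enum {x} {y}
      γ-inj = λ {x} {y} → enum-injective γ-enum {x} {y}
      σ-inj = λ {x} {y} → enum-injective σ-enum {x} {y}

      h₀ : Matrix k n
      h₀ = replace ρ γ σ Cyc L

      h₀-latin : IsLatin h₀
      h₀-latin = replace-isLatin ρ γ σ ρ-inj γ-inj {M} {Cyc} {L} σ-inj latin M-latin Cyc-latin L≡M

      h₀-entry : ∀ i j → entry h₀ (lookup ρ i) (lookup γ j) ≡ lookup σ (i ⊕ j)
      h₀-entry = replace-in ρ γ σ ρ-inj γ-inj

      open Isolate using (Ready; ready; everywhere)

      ready₁ : Ready R C (lookup γ zero) (Vec.map (lookup σ) W₁) h₀
      ready₁ = ready h₀-latin (enum-∈ γ-enum zero) (λ {x} {y} → map-distinct (lookup σ) σ-inj W₁ W₁-inj {x} {y}) full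
        where
        full : ∀ x → Isolate.Everywhere R C (lookup γ zero) h₀ (lookup (Vec.map (lookup σ) W₁) x)
        full x = subst (Isolate.Everywhere R C (lookup γ zero) h₀) (sym (lookup-map x (lookup σ) W₁)) (everywhere
          (λ i∈ → let (p , p≡) = enum-complete ρ-enum i∈
                      (q , q≡) = rows-surjective Cyc Cyc-latin p (lookup W₁ x)
                  in lookup γ q , enum-∈ γ-enum q , trans (cong (λ i → entry h₀ i (lookup γ q)) (sym p≡)) (trans (h₀-entry p q) (cong (lookup σ) q≡)))
          (λ j∈ → let (q , q≡) = enum-complete γ-enum j∈
                      (p , p≡) = cols-surjective Cyc Cyc-latin q (lookup W₁ x)
                  in lookup ρ p , enum-∈ ρ-enum p , trans (cong (entry h₀ _) (sym q≡)) (trans (h₀-entry p q) (cong (lookup σ) p≡))))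

      module After₁ {cs xs h} (chain : Chain R C (lookup γ zero) (Vec.map (lookup σ) W₁) cs xs h₀ h) where

        θ : Fin m → Fin m
        θ = swaps W₁ xs

        h-latin : IsLatin h
        h-latin = chain-isLatin R C _ chain

        h-entry : ∀ i j → j ≢ zero ⊎ θ (i ⊕ j) ≡ three → entry h (lookup ρ i) (lookup γ j) ≡ lookup σ (θ (i ⊕ j))
        h-entry i j intact = trans (chain-entry R C _ chain (enum-∈ ρ-enum i) (enum-∈ γ-enum j) (intact′ intact)) (swapped i j)
          where
          swapped : ∀ i j → swaps (Vec.map (lookup σ) W₁) xs (entry h₀ (lookup ρ i) (lookup γ j)) ≡ lookup σ (θ (i ⊕ j))
          swapped i j = trans (cong (swaps (Vec.map (lookup σ) W₁) xs) (h₀-entry i j)) (swaps-natural (lookup σ) σ-inj W₁ xs (i ⊕ j))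
          intact′ : j ≢ zero ⊎ θ (i ⊕ j) ≡ three → lookup γ j ≢ lookup γ zero ⊎ swaps (Vec.map (lookup σ) W₁) xs (entry h₀ (lookup ρ i) (lookup γ j)) ≡ lookup σ three
          intact′ (inj₁ j≢) = inj₁ (j≢ ∘ γ-inj)
          intact′ (inj₂ eq) = inj₂ (trans (swapped i j) (cong (lookup σ) eq))

        conj-entry : ∀ i j → j ≢ zero ⊎ θ (i ⊕ j) ≡ three → entry (conj h) (lookup ρ i) (lookup σ (θ (i ⊕ j))) ≡ lookup γ j
        conj-entry i j intact = trans (cong (entry (conj h) (lookup ρ i)) (sym (h-entry i j intact))) (conj-left h h-latin (lookup ρ i) (lookup γ j))

        -- Outside column 0 the first chain has only relabelled the symbols by the bijection `θ`, so
        -- the columns in `W₂` still meet every row and every symbol of the subsquare.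
        ready₂ : Ready R S (lookup σ zero) (Vec.map (lookup γ) W₂) (conj h)
        ready₂ = ready (conj-isLatin h h-latin) (enum-∈ σ-enum zero) (λ {x} {y} → map-distinct (lookup γ) γ-inj W₂ W₂-inj {x} {y}) full
          where
          nonzero : ∀ x → lookup W₂ x ≢ zero
          nonzero zero ()
          nonzero one ()
          nonzero two ()
          full : ∀ x → Isolate.Everywhere R S (lookup σ zero) (conj h) (lookup (Vec.map (lookup γ) W₂) x)
          full x = subst (Isolate.Everywhere R S (lookup σ zero) (conj h)) (sym (lookup-map x (lookup γ) W₂)) (everywhere
            (λ i∈ → let (p , p≡) = enum-complete ρ-enum i∈
                    in lookup σ (θ (p ⊕ lookup W₂ x)) , enum-∈ σ-enum (θ (p ⊕ lookup W₂ x)) ,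
                       trans (cong (λ i → entry (conj h) i (lookup σ (θ (p ⊕ lookup W₂ x)))) (sym p≡)) (conj-entry p (lookup W₂ x) (inj₁ (nonzero x))))
            (λ s∈ → let (t , t≡) = enum-complete σ-enum s∈
                        (u , u≡) = swaps⁻¹ W₁ xs t
                        (p , p≡) = cols-surjective Cyc Cyc-latin (lookup W₂ x) u
                    in lookup ρ p , enum-∈ ρ-enum p ,
                       trans (cong (entry (conj h) (lookup ρ p)) (trans (sym t≡) (cong (lookup σ) (trans (sym u≡) (cong θ (sym p≡))))))
                         (conj-entry p (lookup W₂ x) (inj₁ (nonzero x)))))

        υ≢τ : υ xs ≢ τ xs
        υ≢τ eq = contradiction (trans (sym (proj₂ (swaps⁻¹ W₁ xs three))) (trans (cong θ eq) (proj₂ (swaps⁻¹ W₁ xs zero)))) λ ()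

        module After₂ {ss ys f} (chain₂ : Chain R S (lookup σ zero) (Vec.map (lookup γ) W₂) ss ys (conj h) f) where

          η : Fin m → Fin m
          η = swaps W₂ ys

          l≢0 : l ys ≢ zero
          l≢0 eq = contradiction (trans (sym (proj₂ (swaps⁻¹ W₂ ys three))) (trans (cong η eq) (W₂-zero ys))) λ ()

          f-latin : IsLatin f
          f-latin = chain-isLatin R S _ chain₂

          f-entry : ∀ i j → j ≢ zero ⊎ θ (i ⊕ j) ≡ three → θ (i ⊕ j) ≢ zero ⊎ η j ≡ three →
            entry f (lookup ρ i) (lookup σ (θ (i ⊕ j))) ≡ lookup γ (η j)
          f-entry i j intact₁ intact₂ = trans (chain-entry R S _ chain₂ (enum-∈ ρ-enum i) (enum-∈ σ-enum (θ (i ⊕ j))) (intact intact₂)) swapped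
            where
            swapped : swaps (Vec.map (lookup γ) W₂) ys (entry (conj h) (lookup ρ i) (lookup σ (θ (i ⊕ j)))) ≡ lookup γ (η j)
            swapped = trans (cong (swaps (Vec.map (lookup γ) W₂) ys) (conj-entry i j intact₁)) (swaps-natural (lookup γ) γ-inj W₂ ys j)
            intact : θ (i ⊕ j) ≢ zero ⊎ η j ≡ three → lookup σ (θ (i ⊕ j)) ≢ lookup σ zero
              ⊎ swaps (Vec.map (lookup γ) W₂) ys (entry (conj h) (lookup ρ i) (lookup σ (θ (i ⊕ j)))) ≡ lookup γ three
            intact (inj₁ t≢) = inj₁ (t≢ ∘ σ-inj)
            intact (inj₂ eq) = inj₂ (trans swapped (cong (lookup γ) eq))

          remnant : Remnant (τ xs) (υ xs) (l ys) f (lookup ρ) (lookup γ ∘ η) (lookup σ ∘ θ)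
          remnant = record
            { generic = λ i j j≢ t≢ → f-entry i j (inj₁ j≢) (inj₁ λ eq → t≢ (swaps-injective W₁ xs (trans eq (sym τ≡))))
            ; column₀ = λ i eq → subst (λ t → entry f (lookup ρ i) (lookup σ (θ t)) ≡ lookup γ (η zero)) eq
                (f-entry i zero (inj₂ (trans (cong θ eq) υ≡)) (inj₁ λ e → contradiction (trans (sym υ≡) (trans (cong θ (sym eq)) e)) λ ()))
            ; symbolτ = λ i eq → subst (λ t → entry f (lookup ρ i) (lookup σ (θ t)) ≡ lookup γ (η (l ys))) eq
                (f-entry i (l ys) (inj₁ l≢0) (inj₂ (proj₂ (swaps⁻¹ W₂ ys three)))) }
            where
            τ≡ : θ (τ xs) ≡ zero
            τ≡ = proj₂ (swaps⁻¹ W₁ xs zero)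
            υ≡ : θ (υ xs) ≡ three
            υ≡ = proj₂ (swaps⁻¹ W₁ xs three)

    trace-exists : ∀ {L : Matrix k n} {R C} cs ss → IsLatin L → IsSubsquare m L (R , C) →
      (∀ i → lookup cs i ∉ C) → (∀ i → lookup ss i ∉ symbols L R C) →
      ∃[ t ] IsLatin (proj₁ t) × Trace ((L , R , C) , cs , ss) t
    trace-exists {L} {R} {C} cs ss latin sub cs∉ ss∉ =
      let (xs , h , chain₁) = chain-exists R C _ _ cs ready₁ cs∉
          (ys , f , chain₂) = chain-exists R (symbols L R C) _ _ ss (After₁.ready₂ chain₁) ss∉
      in (f , _ , M , xs , ys) , chain-isLatin R (symbols L R C) _ chain₂ ,
         record { sq = sq ; h = h ; chain₁ = chain₁ ; chain₂ = chain₂ ; M≡ = refl ; guess = refl }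
      where
      sq = square latin sub
      open Existence sq
      open Square sq using (M)

    -- Both remnants lie in the same `f` and share the guessed lines, so the walk identifies rows,
    -- columns and symbols. Then the second chain, the conjugation and the first chain are undone,
    -- and `M` is put back for the cyclic square.
    trace-injective : ∀ {s s~ t} → Trace s t → Trace s~ t → s ≡ s~
    trace-injective {((L , R , C) , cs , ss)} {((L~ , R~ , C~) , cs~ , ss~)} {f , gs , Mc , xs , ys} T T~ =
      conclude (vec-ext rows) (vec-ext columns) (vec-ext syms) (trans (sym T.M≡) T~.M≡) T.ρ-enum T.γ-enum T.σ-enum T~.ρ-enum T~.γ-enum T~.σ-enum
        T.chain₁ T.chain₂ T~.chain₁ T~.chain₂ T.L≡M T~.L≡M
      where
      module T = Trace T
      module T~ = Trace T~
      module E = Existence T.sq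
      module E~ = Existence T~.sq
      module A = E.After₁ T.chain₁
      module A~ = E~.After₁ T~.chain₁
      module B = A.After₂ T.chain₂
      module B~ = A~.After₂ T~.chain₂

      guesses : ∀ x → lookup (lookup T.γ (swaps W₂ ys one) ∷ lookup T.γ (swaps W₂ ys two) ∷ lookup T.σ (swaps W₁ xs (Points.point (τ xs) 1)) ∷ []) x
        ≡ lookup (lookup T~.γ (swaps W₂ ys one) ∷ lookup T~.γ (swaps W₂ ys two) ∷ lookup T~.σ (swaps W₁ xs (Points.point (τ xs) 1)) ∷ []) x
      guesses x = cong (λ v → lookup v x) (trans (sym T.guess) T~.guess)

      rows : ∀ i → lookup T.ρ i ≡ lookup T~.ρ i
      rows = rows≡ B.f-latin A.υ≢τ B.l≢0 B.remnant B~.remnant (guesses zero) (guesses one) (guesses two)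

      columns : ∀ j → lookup T.γ j ≡ lookup T~.γ j
      columns j = let (u , eq) = swaps⁻¹ W₂ ys j in subst (λ j → lookup T.γ j ≡ lookup T~.γ j) eq
        (columns≡ B.f-latin A.υ≢τ B.l≢0 B.remnant B~.remnant (guesses zero) (guesses one) (guesses two) u)

      syms : ∀ t → lookup T.σ t ≡ lookup T~.σ t
      syms t = let (u , eq) = swaps⁻¹ W₁ xs t in subst (λ t → lookup T.σ t ≡ lookup T~.σ t) eq
        (symbols≡ B.f-latin A.υ≢τ B.l≢0 B.remnant B~.remnant (guesses zero) (guesses one) (guesses two) u)

      -- Generalised over the fields of both traces, so that the equations can be matched with
      -- `refl`.
      conclude : ∀ {L L~ : Matrix k n} {R R~ C C~ S S~ cs cs~ ss ss~ h h~ M M~} {ρ ρ~ : Vec (Fin k) m} {γ γ~ σ σ~ : Vec (Fin n) m} →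
        ρ ≡ ρ~ → γ ≡ γ~ → σ ≡ σ~ → M ≡ M~ →
        Enumerates R ρ → Enumerates C γ → Enumerates S σ → Enumerates R~ ρ~ → Enumerates C~ γ~ → Enumerates S~ σ~ →
        Chain R C (lookup γ zero) (Vec.map (lookup σ) W₁) cs xs (replace ρ γ σ Cyc L) h →
        Chain R S (lookup σ zero) (Vec.map (lookup γ) W₂) ss ys (conj h) f →
        Chain R~ C~ (lookup γ~ zero) (Vec.map (lookup σ~) W₁) cs~ xs (replace ρ~ γ~ σ~ Cyc L~) h~ →
        Chain R~ S~ (lookup σ~ zero) (Vec.map (lookup γ~) W₂) ss~ ys (conj h~) f →
        (∀ p q → entry L (lookup ρ p) (lookup γ q) ≡ lookup σ (entry M p q)) →
        (∀ p q → entry L~ (lookup ρ~ p) (lookup γ~ q) ≡ lookup σ~ (entry M~ p q)) →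
        _≡_ {A = Source} ((L , R , C) , cs , ss) ((L~ , R~ , C~) , cs~ , ss~)
      conclude {L} {L~} {R} {M = M} {ρ = ρ} {γ = γ} {σ = σ} refl refl refl refl eR eC eS eR~ eC~ eS~ c₁ c₂ c₁~ c₂~ L≡M L~≡M
        with enum-determines eR eR~ | enum-determines eC eC~ | enum-determines eS eS~
      ... | refl | refl | refl with chain-injective R _ _ c₂ c₂~
      ...   | refl , conj≡ with conj-injective _ _ (chain-isLatin R _ _ c₁) (chain-isLatin R _ _ c₁~) conj≡
      ...     | refl with chain-injective R _ _ c₁ c₁~
      ...       | refl , replaced≡ = cong (λ L → (L , _) , _) (trans (sym (undo L≡M))
                    (trans (cong (replace ρ γ σ M) replaced≡) (undo L~≡M)))
        where
        undo : ∀ {L} → (∀ p q → entry L (lookup ρ p) (lookup γ q) ≡ lookup σ (entry M p q)) →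
          replace ρ γ σ M (replace ρ γ σ Cyc L) ≡ L
        undo = replace-undo ρ γ σ (λ {x} {y} → enum-injective eR {x} {y}) (λ {x} {y} → enum-injective eC {x} {y})

  codes : List (Matrix m m × (Codes 3 × Codes 2))
  codes = cartesianProduct (matrices m m) (cartesianProduct (allCodes 3) (allCodes 2))

  opaque
    constant : ℕ
    constant = length codes

    length-codes : length codes ≡ constant
    length-codes = refl

  choices : ∀ {k n} → Matrix k n × (Subset k × Subset n) → List (Vec (Fin n) 3 × Vec (Fin n) 2)
  choices (L , R , C) = cartesianProduct (vectors (outside C) 3) (vectors (outside (symbols L R C)) 2)

  length-cartesianProduct : ∀ {A B : Set} (xs : List A) (ys : List B) → length (cartesianProduct xs ys) ≡ length xs * length ys
  length-cartesianProduct = length-cartesianProductWith _,_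

  length-choices : ∀ {k n} {L : Matrix k n} {R C} → IsSubsquare m L (R , C) → length (choices (L , R , C)) ≡ (n ∸ m) ^ 5
  length-choices {n = n} {L} {R} {C} (_ , ∣C∣ , ∣S∣) = begin
    length (choices (L , R , C))                    ≡⟨ length-cartesianProduct (vectors (outside C) 3) (vectors (outside S) 2) ⟩
    length (vectors (outside C) 3) * length (vectors (outside S) 2)
      ≡⟨ cong₂ _*_ (length-vectors (outside C) 3) (length-vectors (outside S) 2) ⟩
    length (outside C) ^ 3 * length (outside S) ^ 2
      ≡⟨ cong₂ (λ a b → a ^ 3 * b ^ 2) (trans (length-outside C) (cong (n ∸_) ∣C∣)) (trans (length-outside S) (cong (n ∸_) ∣S∣)) ⟩
    (n ∸ m) ^ 3 * (n ∸ m) ^ 2                       ≡⟨ ℕ.^-distribˡ-+-* (n ∸ m) 3 2 ⟨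
    (n ∸ m) ^ 5                                     ∎
    where
    open ≡-Reasoning
    S = symbols L R C

  -- Each located subsquare admits (n - m)⁵ choices, and `Trace` embeds the pairs into Latin
  -- rectangles with three lines and a code.
  bound : ∀ k n → length (located k n m) * (n ∸ m) ^ 5 ≤ length (latinRectangles k n) * (n ^ 3 * constant)
  bound k n = begin
    length (located k n m) * (n ∸ m) ^ 5
      ≡⟨ length-pairs-const (located k n m) choices (λ {a} a∈ → length-choices {L = proj₁ a} {proj₁ (proj₂ a)} {proj₂ (proj₂ a)} (proj₂ (∈-located⁻ {k} {n} {m} a∈))) ⟨
    length (pairs (located k n m) choices)
      ≤⟨ length-injective Trace (pairs-unique _ choices (located-unique k n m) choices-unique) total trace-injective ⟩
    length (cartesianProduct (latinRectangles k n) (cartesianProduct (vectors (allFin n) 3) codes))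
      ≡⟨ length-cartesianProduct (latinRectangles k n) (cartesianProduct (vectors (allFin n) 3) codes) ⟩
    length (latinRectangles k n) * length (cartesianProduct (vectors (allFin n) 3) codes)
      ≡⟨ cong (length (latinRectangles k n) *_) (length-cartesianProduct (vectors (allFin n) 3) codes) ⟩
    length (latinRectangles k n) * (length (vectors (allFin n) 3) * length codes)
      ≡⟨ cong (length (latinRectangles k n) *_) (cong₂ _*_ guesses length-codes) ⟩
    length (latinRectangles k n) * (n ^ 3 * constant) ∎
    where
    open ℕ.≤-Reasoning
    guesses : length (vectors (allFin n) 3) ≡ n ^ 3
    guesses = trans (length-vectors (allFin n) 3) (cong (_^ 3) (length-allFin n))

    choices-unique : ∀ a → Unique (choices {k} {n} a)
    choices-unique (L , R , C) = Unique.cartesianProduct⁺ (vectors-unique 3 (members-unique (∁ C))) (vectors-unique 2 (members-unique (∁ (symbols L R C))))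

    total : ∀ {s : Source {k} {n}} → s ∈ˡ pairs (located k n m) choices →
      ∃[ t ] t ∈ˡ cartesianProduct (latinRectangles k n) (cartesianProduct (vectors (allFin n) 3) codes) × Trace s t
    total {(L , R , C) , cs , ss} s∈ =
      let (a∈ , b∈) = ∈-pairs⁻ (located k n m) choices s∈
          (latin , sub) = ∈-located⁻ {k} {n} {m} a∈
          (cs∈ , ss∈) = ∈-cartesianProduct⁻ (vectors (outside C) 3) (vectors (outside (symbols L R C)) 2) b∈
          (t , t-latin , trace) = trace-exists cs ss latin sub (∈-outside ∘ ∈-vectors⁻ cs∈) (∈-outside ∘ ∈-vectors⁻ ss∈)
      in t , ∈-cartesianProduct⁺ (∈-latinRectangles (proj₁ t) t-latin)
               (∈-cartesianProduct⁺ (∈-vectors ∈-allFin _)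
                 (∈-cartesianProduct⁺ (∈-vectors (∈-vectors ∈-allFin) _) (∈-cartesianProduct⁺ (∈-allCodes _) (∈-allCodes _)))) , trace

-- Subsquares of large order

-- Rows, columns and symbols of a subsquare correspond to each other through the column c₀ and the
-- row r₀; closed sets are the subloops of the resulting loop with identity r₀, in which the products
-- read off the destroyed column c are not available.
module Loop {k n : ℕ} (f : Matrix k n) (r₀ : Fin k) (c₀ c : Fin n) where

  -- Here `j` is the column corresponding to the row `y`, and `z` is the product of `x` and `y`. The
  -- subsquare does not enter, so closed sets from two subsquares of `f` can be intersected.
  Closed′ : Subset k → Set
  Closed′ A = ∀ x → x ∈ A → ∀ y → y ∈ A → ∀ j → entry f r₀ j ≡ entry f y c₀ → j ≢ c → ∀ z → entry f z c₀ ≡ entry f x j → z ∈ A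

  closed? : ∀ A → Dec (Closed′ A)
  closed? A = all? λ x → (x ∈? A) →-dec all? λ y → (y ∈? A) →-dec all? λ j →
    (entry f r₀ j ≟ entry f y c₀) →-dec ¬? (j ≟ c) →-dec all? λ z → (entry f z c₀ ≟ entry f x j) →-dec (z ∈? A)

  closed-∩ : ∀ {A B} → Closed′ A → Closed′ B → Closed′ (A ∩ B)
  closed-∩ {A} {B} clA clB x x∈ y y∈ j eq j≢ z eq′ =
    let (xA , xB) = x∈p∩q⁻ A B x∈
        (yA , yB) = x∈p∩q⁻ A B y∈
    in x∈p∩q⁺ (clA x xA y yA j eq j≢ z eq′ , clB x xB y yB j eq j≢ z eq′)

  -- What survives of the subsquare: row `r₀` still matches `R` with `C`, column `c₀` matches `R`
  -- with `S`, and products through columns other than `c` stay in `R`.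
  record Frame (R : Subset k) (C S : Subset n) : Set where
    field
      r₀∈R       : r₀ ∈ R
      column     : ∀ {i j} → i ∈ R → j ∈ C → j ≢ c → ∃[ z ] z ∈ R × entry f z c₀ ≡ entry f i j
      row⁺       : ∀ {y} → y ∈ R → ∃[ j ] j ∈ C × entry f r₀ j ≡ entry f y c₀
      row⁻       : ∀ {j} → j ∈ C → ∃[ y ] y ∈ R × entry f y c₀ ≡ entry f r₀ j
      symbol⁺    : ∀ {s} → s ∈ S → ∃[ y ] y ∈ R × entry f y c₀ ≡ s
      symbol⁻    : ∀ {y} → y ∈ R → entry f y c₀ ∈ S
  open Frame

  record Generated {t} (R : Subset k) (r₁ : Fin k) (T : Vec (Fin k) t) : Set where
    constructor generated
    field
      r₁∈ : r₁ ∈ R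
      T∈  : ∀ i → lookup T i ∈ R
      all : ∀ A → Closed′ A → (∀ x → x ∈ A → x ∈ R) → r₀ ∈ A → r₁ ∈ A → (∀ i → lookup T i ∈ A) → ∀ x → x ∈ R → x ∈ A

  module _ (latin : IsLatin f) where

    module _ {R C S} (F : Frame R C S) where

      R-closed : Closed′ R
      R-closed x x∈ y y∈ j eq j≢ z eq′ =
        let (j′ , j′∈ , e) = row⁺ F y∈
            j∈ = subst (_∈ C) (proj₁ latin r₀ j′ j (trans e (sym eq))) j′∈
            (z′ , z′∈ , e′) = column F x∈ j∈ j≢
        in subst (_∈ R) (proj₂ latin c₀ z′ z (trans e′ (sym eq′))) z′∈

      -- Right multiplication by y ∈ B permutes B, hence maps z outside B.
      leaves : ∀ {B} → Closed′ B → (∀ {x} → x ∈ B → x ∈ R) → ∀ {y j z w} → y ∈ B → entry f r₀ j ≡ entry f y c₀ → j ≢ c →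
        z ∉ B → entry f w c₀ ≡ entry f z j → w ∉ B
      leaves {B} clB B⊆R {y} {j} {z} {w} y∈ eq j≢ z∉ eq′ w∈ = ℕ.<-irrefl refl
        (length-injective {xs = z ∷ members B} {members B} (λ x u → entry f u c₀ ≡ entry f x j)
          (All.tabulate (λ x∈ z≡x → z∉ (subst (_∈ B) (sym z≡x) (∈-members⁻ x∈))) AllPairs.∷ members-unique B)
          total (λ {x} {x′} e e′ → proj₂ latin j x x′ (trans (sym e) e′)))
        where
        total : ∀ {x} → x ∈ˡ z ∷ members B → ∃[ u ] u ∈ˡ members B × entry f u c₀ ≡ entry f x j
        total (here refl) = w , ∈-members⁺ w∈ , eq′
        total {x} (there x∈) =
          let x∈B = ∈-members⁻ x∈
              (j′ , j′∈ , e) = row⁺ F (B⊆R y∈)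
              (u , _ , e′) = column F (B⊆R x∈B) (subst (_∈ C) (proj₁ latin r₀ j′ j (trans e (sym eq))) j′∈) j≢
          in u , ∈-members⁺ (clB x x∈B y y∈ j eq j≢ u e′) , e′

      doubling : ∀ {A B z} → Closed′ A → Closed′ B → (∀ {x} → x ∈ B → x ∈ A) → (∀ {x} → x ∈ A → x ∈ R) → z ∈ A → z ∉ B →
        ∣ B ∣ + ∣ B ∣ ≤ suc ∣ A ∣
      doubling {A} {B} {z} clA clB B⊆A A⊆R z∈ z∉ = begin
        ∣ B ∣ + ∣ B ∣       ≡⟨ cong₂ _+_ (length-members B) (length-members B) ⟨
        length (members B) + length (members B)
          ≡⟨ cong₂ _+_ (Listₚ.length-map inj₁ (members B)) (Listₚ.length-map inj₂ (members B)) ⟨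
        length (map inj₁ (members B)) + length (map inj₂ (members B)) ≡⟨ Listₚ.length-++ (map inj₁ (members B)) ⟨
        length (map inj₁ (members B) ++ map inj₂ (members B)) ≤⟨ length-injective Rel unique total Rel-inj ⟩
        suc (length (map just (members A)))  ≡⟨ cong suc (trans (Listₚ.length-map just (members A)) (length-members A)) ⟩
        suc ∣ A ∣           ∎
        where
        open ℕ.≤-Reasoning
        B⊆R = λ {x} (x∈ : x ∈ B) → A⊆R (B⊆A x∈)

        Rel : Fin k ⊎ Fin k → Maybe (Fin k) → Set
        Rel (inj₁ y) w = y ∈ B × w ≡ just y
        Rel (inj₂ y) nothing = entry f r₀ c ≡ entry f y c₀
        Rel (inj₂ y) (just w) = w ∉ B × ∃[ j ] entry f r₀ j ≡ entry f y c₀ × entry f w c₀ ≡ entry f z j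

        unique : Unique (map inj₁ (members B) ++ map inj₂ (members B))
        unique = Unique.++⁺ (Unique.map⁺ (λ { refl → refl }) (members-unique B)) (Unique.map⁺ (λ { refl → refl }) (members-unique B))
          (λ (∈₁ , ∈₂) → disjoint (∈-map⁻ inj₁ ∈₁) (∈-map⁻ inj₂ ∈₂))
          where
          disjoint : ∀ {x : Fin k ⊎ Fin k} → ∃[ y ] (y ∈ˡ members B × x ≡ inj₁ y) → ∃[ y ] (y ∈ˡ members B × x ≡ inj₂ y) → ⊥
          disjoint (_ , _ , refl) (_ , _ , ())

        Rel-inj : ∀ {x x′ w} → Rel x w → Rel x′ w → x ≡ x′
        Rel-inj {inj₁ y} {inj₁ y′} (_ , refl) (_ , refl) = refl
        Rel-inj {inj₁ y} {inj₂ y′} {just w} (y∈ , refl) (w∉ , _) = contradiction y∈ w∉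
        Rel-inj {inj₂ y} {inj₁ y′} {just w} (w∉ , _) (y∈ , refl) = contradiction y∈ w∉
        Rel-inj {inj₂ y} {inj₂ y′} {nothing} e e′ = cong inj₂ (proj₂ latin c₀ y y′ (trans (sym e) e′))
        Rel-inj {inj₂ y} {inj₂ y′} {just w} (_ , j , e , d) (_ , j′ , e′ , d′) with proj₁ latin z j j′ (trans (sym d) d′)
        ... | refl = cong inj₂ (proj₂ latin c₀ y y′ (trans (sym e) e′))

        total : ∀ {x} → x ∈ˡ map inj₁ (members B) ++ map inj₂ (members B) → ∃[ w ] w ∈ˡ nothing ∷ map just (members A) × Rel x w
        total x∈ with ∈-++⁻ (map inj₁ (members B)) x∈
        ... | inj₁ x∈₁ with ∈-map⁻ inj₁ x∈₁
        ...   | y , y∈ , refl = just y , there (∈-map⁺ just (∈-members⁺ (B⊆A (∈-members⁻ y∈)))) , ∈-members⁻ y∈ , refl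
        total x∈ | inj₂ x∈₂ with ∈-map⁻ inj₂ x∈₂
        ...   | y , y∈ , refl with row⁺ F (B⊆R (∈-members⁻ y∈))
        ...     | j , j∈ , e with j ≟ c
        ...       | yes refl = nothing , here refl , e
        ...       | no j≢ = let (w , _ , e′) = column F (A⊆R z∈) j∈ j≢
                                y∈B = ∈-members⁻ y∈
                            in just w , there (∈-map⁺ just (∈-members⁺ (clA z z∈ y (B⊆A y∈B) j e j≢ w e′))) ,
                               leaves clB B⊆R y∈B e j≢ z∉ e′ , j , e , e′

      module _ {r₁ : Fin k} (r₁∈R : r₁ ∈ R) (r₀≢r₁ : r₀ ≢ r₁) where

        record Contains {t} (T : Vec (Fin k) t) (A : Subset k) : Set where
          constructor contains
          field
            isClosed : Closed′ A
            ⊆R       : ∀ x → x ∈ A → x ∈ R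
            r₀∈      : r₀ ∈ A
            r₁∈      : r₁ ∈ A
            T∈       : ∀ i → lookup T i ∈ A

        contains? : ∀ {t} (T : Vec (Fin k) t) A → Dec (Contains T A)
        contains? T A with closed? A | all? (λ x → (x ∈? A) →-dec (x ∈? R)) | r₀ ∈? A | r₁ ∈? A | all? (λ i → lookup T i ∈? A)
        ... | yes a | yes b | yes d | yes e | yes g = yes (contains a b d e g)
        ... | no ¬a | _ | _ | _ | _ = no (¬a ∘ Contains.isClosed)
        ... | _ | no ¬a | _ | _ | _ = no (¬a ∘ Contains.⊆R)
        ... | _ | _ | no ¬a | _ | _ = no (¬a ∘ Contains.r₀∈)
        ... | _ | _ | _ | no ¬a | _ = no (¬a ∘ Contains.r₁∈)
        ... | _ | _ | _ | _ | no ¬a = no (¬a ∘ Contains.T∈)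

        two-elements : ∀ {A} → r₀ ∈ A → r₁ ∈ A → 1 < ∣ A ∣
        two-elements {A} r₀∈ r₁∈ = subst (2 ≤_) (length-members A) (length-injective {xs = r₀ ∷ r₁ ∷ []} _≡_
          ((r₀≢r₁ All.∷ All.[]) AllPairs.∷ (All.[] AllPairs.∷ AllPairs.[]))
          (λ { (here refl) → r₀ , ∈-members⁺ r₀∈ , refl ; (there (here refl)) → r₁ , ∈-members⁺ r₁∈ , refl })
          (λ { refl refl → refl }))

        -- With one product missing, a size b grows only to 2b - 1, and sizes of the form 2^t + 1
        -- are stable under this. The start 2 = 2^0 + 1 is provided by `r₀` and `r₁`. If `A` is
        -- proper and the new generator `z` lies outside it, every closed `A′` with the new
        -- generators has `A ∩ A′` as a proper closed subset.
        generators : ∀ t → ∃[ T ] (∀ i → lookup {n = t} T i ∈ R) × (∀ A → Contains T A → (∀ x → x ∈ R → x ∈ A) ⊎ 2 ^ t < ∣ A ∣)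
        generators zero = [] , (λ ()) , λ A ct → inj₂ (two-elements (Contains.r₀∈ ct) (Contains.r₁∈ ct))
        generators (suc t) with generators t
        ... | T , T∈ , grows with anySubset? (λ A → contains? T A ×-dec any? (λ z → (z ∈? R) ×-dec ¬? (z ∈? A)))
        -- The generators already suffice, and `r₀` merely fills up the length.
        ...   | no ¬proper = r₀ ∷ T , (λ { zero → r₀∈R F ; (suc i) → T∈ i }) , λ A (contains a b d e g) →
                  inj₁ λ x x∈ → decidable-stable (x ∈? A) λ x∉ → ¬proper (A , contains a b d e (g ∘ suc) , x , x∈ , x∉)
        ...   | yes (A , ctA , z , z∈R , z∉A) = z ∷ T , (λ { zero → z∈R ; (suc i) → T∈ i }) , λ A′ ctA′ → inj₂ (double A′ ctA′)
          where
          open ℕ.≤-Reasoning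
          double : ∀ A′ → Contains (z ∷ T) A′ → 2 ^ suc t < ∣ A′ ∣
          double A′ ctA′ with grows (A ∩ A′) (contains
              (closed-∩ {A} {A′} (Contains.isClosed ctA) (Contains.isClosed ctA′))
              (λ x x∈ → Contains.⊆R ctA x (proj₁ (x∈p∩q⁻ A A′ x∈)))
              (x∈p∩q⁺ (Contains.r₀∈ ctA , Contains.r₀∈ ctA′))
              (x∈p∩q⁺ (Contains.r₁∈ ctA , Contains.r₁∈ ctA′))
              (λ i → x∈p∩q⁺ (Contains.T∈ ctA i , Contains.T∈ ctA′ (suc i))))
          ... | inj₁ full = contradiction (proj₁ (x∈p∩q⁻ A A′ (full z z∈R))) z∉A
          ... | inj₂ large = s≤s⁻¹ (begin
                suc (suc (2 * 2 ^ t))       ≡⟨ cong (λ a → ℕ.suc (ℕ.suc a)) (cong (2 ^ t +_) (ℕ.+-identityʳ (2 ^ t))) ⟩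
                suc (suc (2 ^ t + 2 ^ t))   ≡⟨ cong suc (ℕ.+-suc (2 ^ t) (2 ^ t)) ⟨
                suc (2 ^ t) + suc (2 ^ t)   ≤⟨ ℕ.+-mono-≤ large large ⟩
                ∣ A ∩ A′ ∣ + ∣ A ∩ A′ ∣     ≤⟨ doubling (Contains.isClosed ctA′)
                    (closed-∩ {A} {A′} (Contains.isClosed ctA) (Contains.isClosed ctA′))
                    (λ x∈ → proj₂ (x∈p∩q⁻ A A′ x∈)) (λ {x} → Contains.⊆R ctA′ x) (Contains.T∈ ctA′ zero)
                    (λ z∈ → z∉A (proj₁ (x∈p∩q⁻ A A′ z∈))) ⟩
                suc ∣ A′ ∣                  ∎)

    generators-exist : ∀ {R C S} → Frame R C S → ∀ {r₁} → r₁ ∈ R → r₀ ≢ r₁ → ∀ t → ∣ R ∣ ≤ 2 ^ t → ∃[ T ] Generated {t} R r₁ T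
    generators-exist {R} F r₁∈ r₀≢r₁ t R≤ with generators F r₁∈ r₀≢r₁ t
    ... | T , T∈ , grows = T , generated r₁∈ T∈ λ A cl ⊆R r₀∈A r₁∈A T∈A → full A ⊆R (grows A (contains cl ⊆R r₀∈A r₁∈A T∈A))
      where
      full : ∀ A → (∀ x → x ∈ A → x ∈ R) → (∀ x → x ∈ R → x ∈ A) ⊎ 2 ^ t < ∣ A ∣ → ∀ x → x ∈ R → x ∈ A
      full A ⊆R (inj₁ all) = all
      full A ⊆R (inj₂ big) = contradiction (ℕ.≤-trans big (ℕ.≤-trans (p⊆q⇒∣p∣≤∣q∣ (λ {x} → ⊆R x)) R≤)) (ℕ.<-irrefl refl)

    module _ {R R~ : Subset k} {C C~ S S~ : Subset n} where

      -- The intersection of `R` and `R~` is closed and contains the common generators, so it is all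
      -- of `R`.
      rows-⊆ : Frame R C S → Frame R~ C~ S~ → ∀ {t r₁} {T : Vec (Fin k) t} → Generated R r₁ T → Generated R~ r₁ T → ∀ {x} → x ∈ R → x ∈ R~
      rows-⊆ F F~ G G~ {x} x∈ = proj₂ (x∈p∩q⁻ R R~ (Generated.all G (R ∩ R~) (closed-∩ {R} {R~} (R-closed F) (R-closed F~))
        (λ x x∈ → proj₁ (x∈p∩q⁻ R R~ x∈)) (x∈p∩q⁺ (r₀∈R F , r₀∈R F~)) (x∈p∩q⁺ (Generated.r₁∈ G , Generated.r₁∈ G~))
        (λ i → x∈p∩q⁺ (Generated.T∈ G i , Generated.T∈ G~ i)) x x∈))

    module _ {R : Subset k} {C C~ S S~ : Subset n} where

      columns-⊆ : Frame R C S → Frame R C~ S~ → ∀ {j} → j ∈ C → j ∈ C~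
      columns-⊆ F F~ {j} j∈ = let (y , y∈ , e) = row⁻ F j∈ ; (j′ , j′∈ , e′) = row⁺ F~ y∈ in
        subst (_∈ C~) (proj₁ latin r₀ j′ j (trans e′ e)) j′∈

      symbols-⊆ : Frame R C S → Frame R C~ S~ → ∀ {s} → s ∈ S → s ∈ S~
      symbols-⊆ F F~ s∈ = let (y , y∈ , e) = symbol⁺ F s∈ in subst (_∈ S~) e (symbol⁻ F~ y∈)

    identify : ∀ {R R~ C C~ S S~} → Frame R C S → Frame R~ C~ S~ → ∀ {t r₁} {T : Vec (Fin k) t} →
      Generated R r₁ T → Generated R~ r₁ T → R ≡ R~ × C ≡ C~ × S ≡ S~
    identify F F~ G G~ with ⊆-antisym (rows-⊆ F F~ G G~) (rows-⊆ F~ F G~ G)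
    ... | refl = refl , ⊆-antisym (columns-⊆ F F~) (columns-⊆ F~ F) , ⊆-antisym (symbols-⊆ F F~) (symbols-⊆ F~ F)

-- The exact number is (g + 1)!, a product of g factors from 2 to g + 1.
length-allCodes : ∀ g → length (allCodes g) ≤ suc g ^ g
length-allCodes zero = ℕ.≤-refl
length-allCodes (suc g) = begin
  length (allCodes (suc g))                     ≡⟨ length-cartesianProductWith _,_ (allFin (2 + g)) (allCodes g) ⟩
  length (allFin (2 + g)) * length (allCodes g) ≡⟨ cong (_* length (allCodes g)) (length-allFin (2 + g)) ⟩
  (2 + g) * length (allCodes g)                 ≤⟨ ℕ.*-monoʳ-≤ (2 + g) (ℕ.≤-trans (length-allCodes g) (ℕ.^-monoˡ-≤ g (ℕ.n≤1+n (suc g)))) ⟩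
  (2 + g) * (2 + g) ^ g                         ∎
  where open ℕ.≤-Reasoning

module Unbounded (m′ g t : ℕ) (g<m : suc g ≤ 2 + m′) (m≤2^t : 2 + m′ ≤ 2 ^ t) where

  m : ℕ
  m = 2 + m′

  embed : Fin (suc g) → Fin m
  embed x = inject≤ x g<m

  W : Vec (Fin m) (suc g)
  W = tabulate embed

  W-inj : Inj (lookup W)
  W-inj {x} {y} eq = inject≤-injective g<m g<m x y (trans (sym (lookup∘tabulate embed x)) (trans eq (lookup∘tabulate embed y)))

  final-map : ∀ {A B : Set} {g} (f : A → B) (V : Vec A (suc g)) → final (Vec.map f V) ≡ f (final V)
  final-map {g = zero} f (v ∷ []) = refl
  final-map {g = suc g} f (_ ∷ V) = final-map f V

  module _ {k n : ℕ} where

    -- The guessed lines are `r₀`, `r₁`, t generators, and the columns `c₀` and `c`, t + 4 in all.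
    -- The subsquare is not made cyclic, so no copy of it is recorded.
    Source Target : Set
    Source = (Matrix k n × (Subset k × Subset n)) × Vec (Fin n) g
    Target = Matrix k n × (Vec (Fin k) (2 + t) × (Vec (Fin n) 2 × Codes g))

    data Trace : Source → Target → Set where
      trace : ∀ {L R C S} (sq : Square m L R C S) (let open Square sq) {cs xs f r₀ r₁ T} →
        Chain R C (lookup γ zero) (Vec.map (lookup σ) W) cs xs L f →
        (let open Loop f r₀ (lookup γ (suc zero)) (lookup γ zero)) → Frame R C S → Generated R r₁ T →
        Trace ((L , R , C) , cs) (f , r₀ ∷ r₁ ∷ T , lookup γ (suc zero) ∷ lookup γ zero ∷ [] , xs)

    module _ {L : Matrix k n} {R C S} (sq : Square m L R C S) where
      open Square sq
      open Isolate R C (lookup γ zero) using (Ready; ready; Everywhere; everywhere)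

      isReady : Ready (Vec.map (lookup σ) W) L
      isReady = ready latin (enum-∈ γ-enum zero) (λ {x} {y} → map-distinct (lookup σ) (λ {a} {b} → enum-injective σ-enum {a} {b}) W (λ {a} {b} → W-inj {a} {b}) {x} {y}) full′
        where
        full′ : ∀ x → Everywhere L (lookup (Vec.map (lookup σ) W) x)
        full′ x = subst (Everywhere L) (sym (lookup-map x (lookup σ) W)) (everywhere
          (λ i∈ → let (p , p≡) = enum-complete ρ-enum i∈
                      (q , q≡) = rows-surjective M M-latin p (lookup W x)
                  in lookup γ q , enum-∈ γ-enum q , trans (cong (λ i → entry L i (lookup γ q)) (sym p≡)) (trans (L≡M p q) (cong (lookup σ) q≡)))
          (λ {j} j∈ → let (q , q≡) = enum-complete γ-enum j∈
                          (p , p≡) = cols-surjective M M-latin q (lookup W x)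
                  in lookup ρ p , enum-∈ ρ-enum p , trans (cong (entry L (lookup ρ p)) (sym q≡)) (trans (L≡M p q) (cong (lookup σ) p≡))))

      module _ {cs xs f} (chain : Chain R C (lookup γ zero) (Vec.map (lookup σ) W) cs xs L f) where

        private
          θ : Fin m → Fin m
          θ = swaps W xs

          f-entry : ∀ p q → q ≢ zero ⊎ θ (entry M p q) ≡ final W → entry f (lookup ρ p) (lookup γ q) ≡ lookup σ (θ (entry M p q))
          f-entry p q intact = trans (chain-entry R C _ chain (enum-∈ ρ-enum p) (enum-∈ γ-enum q) (intact′ intact)) swapped
            where
            swapped : swaps (Vec.map (lookup σ) W) xs (entry L (lookup ρ p) (lookup γ q)) ≡ lookup σ (θ (entry M p q))
            swapped = trans (cong (swaps (Vec.map (lookup σ) W) xs) (L≡M p q)) (swaps-natural (lookup σ) (λ {a} {b} → enum-injective σ-enum {a} {b}) W xs (entry M p q))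
            intact′ : q ≢ zero ⊎ θ (entry M p q) ≡ final W →
              lookup γ q ≢ lookup γ zero ⊎ swaps (Vec.map (lookup σ) W) xs (entry L (lookup ρ p) (lookup γ q)) ≡ final (Vec.map (lookup σ) W)
            intact′ (inj₁ q≢) = inj₁ (q≢ ∘ enum-injective γ-enum)
            intact′ (inj₂ eq) = inj₂ (trans swapped (trans (cong (lookup σ) eq) (sym (final-map (lookup σ) W))))

          θ-surjective : ∀ s → ∃[ u ] θ u ≡ s
          θ-surjective = injective⇒surjective θ (swaps-injective W xs)

          -- In this row the final value survives in the destroyed column. All cells of the row are
          -- intact, and it can serve as `r₀`.
          intact-row : ∃[ p ] θ (entry M p zero) ≡ final W
          intact-row = let (u , u≡) = θ-surjective (final W) ; (p , p≡) = cols-surjective M M-latin zero u in p , trans (cong θ p≡) u≡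

          p₀ = proj₁ intact-row
          r₀ = lookup ρ p₀
          c₀ = lookup γ (suc zero)

          f-row : ∀ q → entry f r₀ (lookup γ q) ≡ lookup σ (θ (entry M p₀ q))
          f-row zero = f-entry p₀ zero (inj₂ (proj₂ intact-row))
          f-row (suc q) = f-entry p₀ (suc q) (inj₁ λ ())

          f-column : ∀ p → entry f (lookup ρ p) c₀ ≡ lookup σ (θ (entry M p (suc zero)))
          f-column p = f-entry p (suc zero) (inj₁ λ ())

          f-latin : IsLatin f
          f-latin = chain-isLatin R C _ chain

        open Loop f r₀ c₀ (lookup γ zero)

        frame : Frame R C S
        frame = record
          { r₀∈R = enum-∈ ρ-enum p₀
          ; column = column′
          ; row⁺ = row⁺′
          ; row⁻ = row⁻′
          ; symbol⁺ = λ s∈ → let (s′ , s≡) = enum-complete σ-enum s∈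
                                 (u , u≡) = θ-surjective s′
                                 (p , p≡) = cols-surjective M M-latin (suc zero) u
                             in lookup ρ p , enum-∈ ρ-enum p , trans (f-column p) (trans (cong (lookup σ) (trans (cong θ p≡) u≡)) s≡)
          ; symbol⁻ = λ y∈ → let (p , p≡) = enum-complete ρ-enum y∈ in
              subst (_∈ S) (trans (sym (f-column p)) (cong (λ y → entry f y c₀) p≡)) (enum-∈ σ-enum _) }
          where
          column′ : ∀ {i j} → i ∈ R → j ∈ C → j ≢ lookup γ zero → ∃[ z ] z ∈ R × entry f z c₀ ≡ entry f i j
          column′ i∈ j∈ j≢ with enum-complete ρ-enum i∈ | enum-complete γ-enum j∈
          ... | p , refl | q , refl = let (p′ , p≡) = cols-surjective M M-latin (suc zero) (entry M p q) in
            lookup ρ p′ , enum-∈ ρ-enum p′ , trans (f-column p′) (trans (cong (lookup σ ∘ θ) p≡) (sym (f-entry p q (inj₁ (j≢ ∘ cong (lookup γ))))))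
          row⁺′ : ∀ {y} → y ∈ R → ∃[ j ] j ∈ C × entry f r₀ j ≡ entry f y c₀
          row⁺′ y∈ = let (p , p≡) = enum-complete ρ-enum y∈
                         (q , q≡) = rows-surjective M M-latin p₀ (entry M p (suc zero))
                     in lookup γ q , enum-∈ γ-enum q ,
                        trans (f-row q) (trans (cong (lookup σ ∘ θ) q≡) (trans (sym (f-column p)) (cong (λ y → entry f y c₀) p≡)))
          row⁻′ : ∀ {j} → j ∈ C → ∃[ y ] y ∈ R × entry f y c₀ ≡ entry f r₀ j
          row⁻′ j∈ = let (q , q≡) = enum-complete γ-enum j∈
                         (p , p≡) = cols-surjective M M-latin (suc zero) (entry M p₀ q)
                     in lookup ρ p , enum-∈ ρ-enum p ,
                        trans (f-column p) (trans (cong (lookup σ ∘ θ) p≡) (trans (sym (f-row q)) (cong (entry f r₀) q≡)))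

        another-row : ∀ p → Dec (p ≡ zero) → ∃[ r₁ ] r₁ ∈ R × lookup ρ p ≢ r₁
        another-row p (no p≢) = lookup ρ zero , enum-∈ ρ-enum zero , p≢ ∘ enum-injective ρ-enum
        another-row p (yes refl) = lookup ρ (suc zero) , enum-∈ ρ-enum (suc zero) , λ eq → contradiction (enum-injective ρ-enum {zero} {suc zero} eq) λ ()

        trace-of : ∣ R ∣ ≡ m → ∃[ z ] IsLatin (proj₁ z) × Trace ((L , R , C) , cs) z
        trace-of ∣R∣ =
          let (r₁ , r₁∈ , r₀≢r₁) = another-row p₀ (p₀ ≟ zero)
              (T , G) = generators-exist f-latin frame r₁∈ r₀≢r₁ t (subst (_≤ 2 ^ t) (sym ∣R∣) m≤2^t)
          in (f , r₀ ∷ r₁ ∷ T , c₀ ∷ lookup γ zero ∷ [] , xs) , f-latin , trace sq chain frame G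

    trace-exists : ∀ {L : Matrix k n} {R C} cs → IsLatin L → IsSubsquare m L (R , C) → (∀ i → lookup cs i ∉ C) →
      ∃[ z ] IsLatin (proj₁ z) × Trace ((L , R , C) , cs) z
    trace-exists {R = R} {C} cs latin sub cs∉ =
      let sq = square latin sub
          (xs , f , chain) = chain-exists R C _ _ cs (isReady sq) cs∉
      in trace-of sq chain (proj₁ sub)

    -- The guessed lines determine `R`, `C` and `S` by `identify`. Then `σ` is fixed as well and `c`
    -- was guessed, so both chains run on the same data and `chain-injective` applies.
    trace-injective : ∀ {s s~ z} → Trace s z → Trace s~ z → s ≡ s~
    trace-injective (trace {L} {R} {C} sq {cs} {xs} {f} {r₀} {r₁} {T} chain frame gen) t~ = compare t~ refl
      where
      open Square sq
      f-latin = chain-isLatin R C _ chain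

      conclude : ∀ {R~ C~ S S~ c cs~ L~ σ σ~} → R ≡ R~ × C ≡ C~ × S ≡ S~ → Enumerates S σ → Enumerates S~ σ~ →
        Chain R C c (Vec.map (lookup σ) W) cs xs L f → Chain R~ C~ c (Vec.map (lookup σ~) W) cs~ xs L~ f →
        _≡_ {A = Source} ((L , R , C) , cs) ((L~ , R~ , C~) , cs~)
      conclude (refl , refl , refl) e e~ chain chain~ with enum-unique e e~
      ... | refl with chain-injective R C _ chain chain~
      ...   | refl , refl = refl

      identified : ∀ {L~ R~ C~ S~} (sq~ : Square m L~ R~ C~ S~) {f~ r₀~ r₁~ T~ c₀~ c~ cs~ xs~} →
        _≡_ {A = Target} (f~ , r₀~ ∷ r₁~ ∷ T~ , c₀~ ∷ c~ ∷ [] , xs~) (f , r₀ ∷ r₁ ∷ T , lookup γ (suc zero) ∷ lookup γ zero ∷ [] , xs) →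
        Chain R~ C~ c~ (Vec.map (lookup (Square.σ sq~)) W) cs~ xs~ L~ f~ →
        Loop.Frame f~ r₀~ c₀~ c~ R~ C~ S~ → Loop.Generated f~ r₀~ c₀~ c~ R~ r₁~ T~ →
        _≡_ {A = Source} ((L , R , C) , cs) ((L~ , R~ , C~) , cs~)
      identified sq~ refl chain~ frame~ gen~ =
        conclude (Loop.identify f r₀ (lookup γ (suc zero)) (lookup γ zero) f-latin frame frame~ gen gen~) σ-enum (Square.σ-enum sq~) chain chain~

      compare : ∀ {s~ z} → Trace s~ z → z ≡ (f , r₀ ∷ r₁ ∷ T , lookup γ (suc zero) ∷ lookup γ zero ∷ [] , xs) → ((L , R , C) , cs) ≡ s~
      compare (trace sq~ chain~ frame~ gen~) eq = identified sq~ eq chain~ frame~ gen~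

  choices : ∀ {k n} → Matrix k n × (Subset k × Subset n) → List (Vec (Fin n) g)
  choices (L , R , C) = vectors (outside C) g

  bound : ∀ k n → length (located k n m) * (n ∸ m) ^ g ≤ length (latinRectangles k n) * (k ^ (2 + t) * (n ^ 2 * suc g ^ g))
  bound k n = begin
    length (located k n m) * (n ∸ m) ^ g
      ≡⟨ length-pairs-const (located k n m) choices (λ {a} a∈ → length-choices {proj₁ a} {proj₁ (proj₂ a)} {proj₂ (proj₂ a)} (proj₂ (∈-located⁻ {k} {n} {m} a∈))) ⟨
    length (pairs (located k n m) choices)
      ≤⟨ length-injective Trace (pairs-unique _ choices (located-unique k n m) (λ (L , R , C) → vectors-unique g (members-unique (∁ C)))) total trace-injective ⟩
    length (cartesianProduct (latinRectangles k n) (cartesianProduct rows (cartesianProduct columns (allCodes g))))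
      ≡⟨ length-cartesianProductWith _,_ (latinRectangles k n) (cartesianProduct rows (cartesianProduct columns (allCodes g))) ⟩
    length (latinRectangles k n) * length (cartesianProduct rows (cartesianProduct columns (allCodes g)))
      ≡⟨ cong (length (latinRectangles k n) *_) (trans (length-cartesianProductWith _,_ rows (cartesianProduct columns (allCodes g)))
           (cong₂ _*_ (length-rows k (2 + t)) (trans (length-cartesianProductWith _,_ columns (allCodes g)) (cong (_* length (allCodes g)) (length-rows n 2))))) ⟩
    length (latinRectangles k n) * (k ^ (2 + t) * (n ^ 2 * length (allCodes g)))
      ≤⟨ ℕ.*-monoʳ-≤ (length (latinRectangles k n)) (ℕ.*-monoʳ-≤ (k ^ (2 + t)) (ℕ.*-monoʳ-≤ (n ^ 2) (length-allCodes g))) ⟩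
    length (latinRectangles k n) * (k ^ (2 + t) * (n ^ 2 * suc g ^ g)) ∎
    where
    open ℕ.≤-Reasoning
    rows = vectors (allFin k) (2 + t)
    columns = vectors (allFin n) 2

    length-rows : ∀ k e → length (vectors (allFin k) e) ≡ k ^ e
    length-rows k e = trans (length-vectors (allFin k) e) (cong (_^ e) (length-allFin k))

    length-choices : ∀ {L : Matrix k n} {R C} → IsSubsquare m L (R , C) → length (choices (L , R , C)) ≡ (n ∸ m) ^ g
    length-choices {C = C} (_ , ∣C∣ , _) = trans (length-vectors (outside C) g)
      (cong (_^ g) (trans (length-outside C) (cong (n ∸_) ∣C∣)))

    total : ∀ {s : Source {k} {n}} → s ∈ˡ pairs (located k n m) choices →
      ∃[ z ] z ∈ˡ cartesianProduct (latinRectangles k n) (cartesianProduct rows (cartesianProduct columns (allCodes g))) × Trace s z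
    total {(L , R , C) , cs} s∈ =
      let (a∈ , cs∈) = ∈-pairs⁻ (located k n m) choices s∈
          (latin , sub) = ∈-located⁻ {k} {n} {m} a∈
          (z , z-latin , tr) = trace-exists cs latin sub (∈-outside ∘ ∈-vectors⁻ cs∈)
      in z , ∈-cartesianProduct⁺ (∈-latinRectangles (proj₁ z) z-latin)
               (∈-cartesianProduct⁺ (∈-vectors ∈-allFin _) (∈-cartesianProduct⁺ (∈-vectors ∈-allFin _) (∈-allCodes _))) , tr

-- Asymptotics

power-between : ∀ m → 1 ≤ m → ∃[ t ] m ≤ 2 ^ t × 2 ^ t < 2 * m
power-between (suc zero) _ = 0 , s≤s z≤n , s≤s (s≤s z≤n)
power-between (suc m@(suc _)) _ with power-between m (s≤s z≤n)
... | t , m≤ , <2m with suc m ℕ.≤? 2 ^ t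
...   | yes sm≤ = t , sm≤ , ℕ.<-≤-trans <2m (ℕ.*-monoʳ-≤ 2 (ℕ.n≤1+n m))
...   | no sm≰ = suc t , upper , ℕ.<-≤-trans (ℕ.*-monoʳ-< 2 (ℕ.≰⇒> sm≰)) ℕ.≤-refl
  where
  upper : suc m ≤ 2 * 2 ^ t
  upper = ℕ.≤-trans (ℕ.+-mono-≤ (ℕ.≤-trans (s≤s z≤n) m≤) m≤) (ℕ.≤-reflexive (cong (2 ^ t +_) (sym (ℕ.+-identityʳ (2 ^ t)))))

square-step : ∀ a → 16 ≤ a → (4 + a) ^ 2 ≤ 2 * a ^ 2
square-step a 16≤a = begin
  (4 + a) ^ 2            ≡⟨ solve 1 (λ a → (con 4 :+ a) :* ((con 4 :+ a) :* con 1) := a :* (a :* con 1) :+ (con 8 :* a :+ con 16)) refl a ⟩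
  a ^ 2 + (8 * a + 16)   ≤⟨ ℕ.+-monoʳ-≤ (a ^ 2) (begin
      8 * a + 16             ≤⟨ ℕ.+-monoʳ-≤ (8 * a) 16≤a ⟩
      8 * a + a              ≡⟨ ℕ.+-comm (8 * a) a ⟩
      9 * a                  ≤⟨ ℕ.*-monoˡ-≤ a (ℕ.≤-trans (ℕ.m≤m+n 9 7) 16≤a) ⟩
      a * a                  ≡⟨ cong (a *_) (ℕ.*-identityʳ a) ⟨
      a ^ 2                  ∎) ⟩
  a ^ 2 + a ^ 2          ≡⟨ cong (a ^ 2 +_) (ℕ.+-identityʳ (a ^ 2)) ⟨
  2 * a ^ 2              ∎
  where
  open ℕ.≤-Reasoning
  open +-*-Solver

square-growth : ∀ a K → 16 ≤ a → a ^ 2 ≤ K → ∀ d → (a + 4 * d) ^ 2 ≤ 2 ^ d * K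
square-growth a K 16≤a a²≤K zero = begin
  (a + 0) ^ 2        ≡⟨ cong (_^ 2) (ℕ.+-identityʳ a) ⟩
  a ^ 2              ≤⟨ a²≤K ⟩
  K                  ≡⟨ ℕ.*-identityˡ K ⟨
  1 * K              ∎
  where open ℕ.≤-Reasoning
square-growth a K 16≤a a²≤K (suc d) = begin
  (a + 4 * suc d) ^ 2           ≡⟨ cong (_^ 2) (solve 2 (λ a d → a :+ con 4 :* (con 1 :+ d) := con 4 :+ (a :+ con 4 :* d)) refl a d) ⟩
  (4 + (a + 4 * d)) ^ 2         ≤⟨ square-step (a + 4 * d) (ℕ.≤-trans 16≤a (ℕ.m≤m+n a (4 * d))) ⟩
  2 * (a + 4 * d) ^ 2           ≤⟨ ℕ.*-monoʳ-≤ 2 (square-growth a K 16≤a a²≤K d) ⟩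
  2 * (2 ^ d * K)               ≡⟨ ℕ.*-assoc 2 (2 ^ d) K ⟨
  2 ^ suc d * K                 ∎
  where
  open ℕ.≤-Reasoning
  open +-*-Solver

-- Raising t by 1 at most doubles the left side. The induction starts from 78² = 6084 ≤ 8192 = 2^13;
-- at t = 12 one still has 74² = 5476 > 4096.
square≤power : ∀ {t} → 13 ≤ t → (26 + 4 * t) ^ 2 ≤ 2 ^ t
square≤power {t} 13≤t = subst (λ t → (26 + 4 * t) ^ 2 ≤ 2 ^ t) (ℕ.m∸n+n≡m 13≤t) (begin
  (26 + 4 * (d + 13)) ^ 2   ≡⟨ cong (_^ 2) (solve 1 (λ d → con 26 :+ con 4 :* (d :+ con 13) := con 78 :+ con 4 :* d) refl d) ⟩
  (78 + 4 * d) ^ 2          ≤⟨ square-growth 78 (2 ^ 13) (ℕ.m≤m+n 16 62) (toWitness {a? = (78 ^ 2) ℕ.≤? (2 ^ 13)} _) d ⟩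
  2 ^ d * 2 ^ 13            ≡⟨ ℕ.^-distribˡ-+-* 2 d 13 ⟨
  2 ^ (d + 13)              ∎)
  where
  open ℕ.≤-Reasoning
  open +-*-Solver
  d = t ∸ 13

^-distribʳ-* : ∀ e a b → (a * b) ^ e ≡ a ^ e * b ^ e
^-distribʳ-* zero a b = refl
^-distribʳ-* (suc e) a b = trans (cong (a * b *_) (^-distribʳ-* e a b)) (ℕ.[m*n]*[o*p]≡[m*o]*[n*p] a b (a ^ e) (b ^ e))

half : ∀ {m n} → 2 * m ≤ n → n ≤ 2 * (n ∸ m)
half {m} {n} 2m≤n = begin
  n                    ≡⟨ ℕ.m∸n+n≡m (ℕ.≤-trans (ℕ.m≤m+n m _) 2m≤n) ⟨
  n ∸ m + m            ≤⟨ ℕ.+-monoʳ-≤ (n ∸ m) (ℕ.≤-trans (ℕ.≤-reflexive (sym (ℕ.m+n∸m≡n m m))) (ℕ.∸-monoˡ-≤ m (ℕ.≤-trans (ℕ.≤-reflexive (cong (m +_) (sym (ℕ.+-identityʳ m)))) 2m≤n))) ⟩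
  n ∸ m + (n ∸ m)      ≡⟨ cong (n ∸ m +_) (ℕ.+-identityʳ (n ∸ m)) ⟨
  2 * (n ∸ m)          ∎
  where open ℕ.≤-Reasoning

-- As n ≤ 2 (n - m), a gain of (n - m)^(a + b) against n^a guesses amounts to n^b up to the factor
-- 2^(a + b).
divide-out : ∀ {N ℓ D m n} a b .{{_ : NonZero n}} → 2 * m ≤ n → N * (n ∸ m) ^ (a + b) ≤ ℓ * (n ^ a * D) → N * n ^ b ≤ 2 ^ (a + b) * D * ℓ
divide-out {N} {ℓ} {D} {m} {n} a b 2m≤n bound = ℕ.*-cancelʳ-≤ _ _ (n ^ a) {{ℕ.m^n≢0 n a}} (begin
  N * n ^ b * n ^ a                    ≡⟨ trans (ℕ.*-assoc N (n ^ b) (n ^ a)) (cong (N *_) (trans (ℕ.*-comm (n ^ b) (n ^ a)) (sym (ℕ.^-distribˡ-+-* n a b)))) ⟩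
  N * n ^ (a + b)                      ≤⟨ ℕ.*-monoʳ-≤ N (ℕ.^-monoˡ-≤ (a + b) (half {m} 2m≤n)) ⟩
  N * (2 * (n ∸ m)) ^ (a + b)          ≡⟨ cong (N *_) (^-distribʳ-* (a + b) 2 (n ∸ m)) ⟩
  N * (2 ^ (a + b) * (n ∸ m) ^ (a + b)) ≡⟨ solve 3 (λ N p q → N :* (p :* q) := p :* (N :* q)) refl N (2 ^ (a + b)) ((n ∸ m) ^ (a + b)) ⟩
  2 ^ (a + b) * (N * (n ∸ m) ^ (a + b)) ≤⟨ ℕ.*-monoʳ-≤ (2 ^ (a + b)) bound ⟩
  2 ^ (a + b) * (ℓ * (n ^ a * D))      ≡⟨ solve 4 (λ p ℓ q D → p :* (ℓ :* (q :* D)) := p :* D :* ℓ :* q) refl (2 ^ (a + b)) ℓ (n ^ a) D ⟩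
  2 ^ (a + b) * D * ℓ * n ^ a          ∎)
  where
  open ℕ.≤-Reasoning
  open +-*-Solver

opaque
  bounded-on : (F : ℕ → ℕ) → ∀ M → ∃[ D ] ∀ m → m ≤ M → F m ≤ D
  bounded-on F zero = F 0 , λ { zero z≤n → ℕ.≤-refl }
  bounded-on F (suc M) with bounded-on F M
  ... | D , bound = D ⊔ F (suc M) , λ m m≤ → go m (ℕ.m≤n⇒m<n∨m≡n m≤)
    where
    go : ∀ m → m < suc M ⊎ m ≡ suc M → F m ≤ D ⊔ F (suc M)
    go m (inj₁ m<) = ℕ.≤-trans (bound m (s≤s⁻¹ m<)) (ℕ.m≤m⊔n D _)
    go m (inj₂ refl) = ℕ.m≤n⊔m D _

-- Of the g = a + 2 + e steps, a pay for the guessed lines and e for the codes together with the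
-- factor 2^g: as g = 2e, (2 (g + 1))^g = ((2 (g + 1))²)^e ≤ n^e. The other two give n².
large-count : ∀ {m′ k n} t a e g → a ≡ 4 + t → g ≡ 2 * e → g ≡ a + (2 + e) → (2 * suc g) ^ 2 ≤ 2 ^ t →
  2 + m′ ≤ 2 ^ t → 2 ^ t < 2 * (2 + m′) → k ≤ n → 2 * (2 + m′) ≤ n →
  length (located k n (2 + m′)) * n ^ 2 ≤ length (latinRectangles k n)
large-count {m′} {k} {n} t a e g a≡ g≡2e g≡ small m≤ <2m k≤n 2m≤n =
  ℕ.*-cancelʳ-≤ _ _ (n ^ e) {{ℕ.m^n≢0 n e {{n≢0}}}} (begin
    N * n ^ 2 * n ^ e                ≡⟨ trans (ℕ.*-assoc N (n ^ 2) (n ^ e)) (cong (N *_) (sym (ℕ.^-distribˡ-+-* n 2 e))) ⟩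
    N * n ^ (2 + e)                  ≤⟨ divide-out {N} {ℓ} {suc g ^ g} {m} a (2 + e) {{n≢0}} 2m≤n bound′ ⟩
    2 ^ (a + (2 + e)) * suc g ^ g * ℓ ≡⟨ cong (λ x → 2 ^ x * suc g ^ g * ℓ) g≡ ⟨
    2 ^ g * suc g ^ g * ℓ            ≡⟨ cong (_* ℓ) (^-distribʳ-* g 2 (suc g)) ⟨
    (2 * suc g) ^ g * ℓ              ≡⟨ cong (λ x → (2 * suc g) ^ x * ℓ) g≡2e ⟩
    (2 * suc g) ^ (2 * e) * ℓ        ≡⟨ cong (_* ℓ) (ℕ.^-*-assoc (2 * suc g) 2 e) ⟨
    ((2 * suc g) ^ 2) ^ e * ℓ        ≤⟨ ℕ.*-monoˡ-≤ ℓ (ℕ.^-monoˡ-≤ e (ℕ.≤-trans small (ℕ.≤-trans (ℕ.<⇒≤ <2m) 2m≤n))) ⟩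
    n ^ e * ℓ                        ≡⟨ ℕ.*-comm (n ^ e) ℓ ⟩
    ℓ * n ^ e                        ∎)
  where
  open ℕ.≤-Reasoning
  m = 2 + m′
  N = length (located k n m)
  ℓ = length (latinRectangles k n)

  n≢0 : NonZero n
  n≢0 = >-nonZero (ℕ.≤-trans (s≤s z≤n) 2m≤n)

  -- Enough symbols are present, because 2 (g + 1) ≤ (2 (g + 1))² ≤ 2^t < 2m.
  g<m : suc g ≤ m
  g<m = ℕ.<⇒≤ (ℕ.*-cancelˡ-< 2 (suc g) m (ℕ.≤-<-trans
    (ℕ.≤-trans (ℕ.m≤m*n (2 * suc g) (2 * suc g * 1)) small) <2m))

  powers : n ^ (2 + t) * n ^ 2 ≡ n ^ a
  powers = trans (ℕ.*-comm (n ^ (2 + t)) (n ^ 2)) (trans (sym (ℕ.^-distribˡ-+-* n 2 (2 + t))) (cong (n ^_) (sym a≡)))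

  bound′ : N * (n ∸ m) ^ (a + (2 + e)) ≤ ℓ * (n ^ a * suc g ^ g)
  bound′ = begin
    N * (n ∸ m) ^ (a + (2 + e))              ≡⟨ cong (λ x → N * (n ∸ m) ^ x) g≡ ⟨
    N * (n ∸ m) ^ g                          ≤⟨ Unbounded.bound m′ g t g<m m≤ k n ⟩
    ℓ * (k ^ (2 + t) * (n ^ 2 * suc g ^ g))  ≤⟨ ℕ.*-monoʳ-≤ ℓ (ℕ.*-monoˡ-≤ (n ^ 2 * suc g ^ g) (ℕ.^-monoˡ-≤ (2 + t) k≤n)) ⟩
    ℓ * (n ^ (2 + t) * (n ^ 2 * suc g ^ g))  ≡⟨ cong (ℓ *_) (ℕ.*-assoc (n ^ (2 + t)) (n ^ 2) (suc g ^ g)) ⟨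
    ℓ * (n ^ (2 + t) * n ^ 2 * suc g ^ g)    ≡⟨ cong (λ x → ℓ * (x * suc g ^ g)) powers ⟩
    ℓ * (n ^ a * suc g ^ g)                  ∎

large-case : ∀ {k n} m t → 4 ≤ m → (26 + 4 * t) ^ 2 ≤ 2 ^ t → m ≤ 2 ^ t → 2 ^ t < 2 * m → k ≤ n → 2 * m ≤ n →
  length (located k n m) * n ^ 2 ≤ length (latinRectangles k n)
large-case (suc zero) t (s≤s ())
-- The value e = t + 6 solves 2e = (t + 4) + (2 + e), and then 2 (2e + 1) = 4t + 26.
large-case (suc (suc m′)) t _ small = large-count t (4 + t) (6 + t) (2 * (6 + t)) refl refl
  (solve 1 (λ t → con 2 :* (con 6 :+ t) := con 4 :+ t :+ (con 8 :+ t)) refl t)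
  (subst (λ x → x ^ 2 ≤ 2 ^ t) (solve 1 (λ t → con 26 :+ con 4 :* t := con 2 :* (con 1 :+ con 2 :* (con 6 :+ t))) refl t) small)
  where open +-*-Solver

bounded-case : ∀ {k n} m′ → 2 * (4 + m′) ≤ n →
  length (located k n (4 + m′)) * n ^ 2 ≤ 2 ^ 5 * Bounded.constant m′ * length (latinRectangles k n)
bounded-case {k} {n} m′ 2m≤n =
  divide-out {length (located k n (4 + m′))} {length (latinRectangles k n)} {Bounded.constant m′} {4 + m′} 3 2 {{>-nonZero (ℕ.≤-trans (s≤s z≤n) 2m≤n)}} 2m≤n (Bounded.bound m′ k n)

opaque
  uniform-bound : ∃[ D ] ∀ m k n → 4 ≤ m → 2 * m ≤ n → k ≤ n →
    length (located k n m) * n ^ 2 ≤ D * length (latinRectangles k n)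
  uniform-bound with bounded-on (λ m′ → 2 ^ 5 * Bounded.constant m′) (2 ^ 12)
  -- If t ≤ 12 then m ≤ 2^12, so finitely many constants of the bounded case have to be dominated;
  -- the successor also covers the constant 1 of the large case.
  ... | D , bound = suc D , go
    where
    go : ∀ m k n → 4 ≤ m → 2 * m ≤ n → k ≤ n → length (located k n m) * n ^ 2 ≤ suc D * length (latinRectangles k n)
    go m k n 4≤m 2m≤n k≤n with power-between m (ℕ.≤-trans (s≤s z≤n) 4≤m)
    ... | t , m≤ , <2m with 13 ℕ.≤? t
    ...   | yes 13≤t = ℕ.≤-trans (large-case m t 4≤m (square≤power 13≤t) m≤ <2m k≤n 2m≤n) (ℕ.m≤m+n _ _)
    ...   | no 13≰t = ℕ.≤-trans (small (m ∸ 4) (sym (ℕ.m+[n∸m]≡n 4≤m))) (ℕ.*-monoˡ-≤ _ (ℕ.≤-trans (bound (m ∸ 4)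
              (ℕ.≤-trans (ℕ.m∸n≤m m 4) (ℕ.≤-trans m≤ (ℕ.^-monoʳ-≤ 2 (s≤s⁻¹ (ℕ.≰⇒> 13≰t)))))) (ℕ.n≤1+n D)))
      where
      small : ∀ m′ → m ≡ 4 + m′ → length (located k n m) * n ^ 2 ≤ 2 ^ 5 * Bounded.constant m′ * length (latinRectangles k n)
      small m′ refl = bounded-case {k} {n} m′ 2m≤n

-- From counting to rational expectations

ratio-≤ : ∀ s ℓ D d .{{_ : NonZero ℓ}} .{{_ : NonZero d}} → s * d ≤ D * ℓ →
  ℚ.∣ ℤ.+ s / ℓ ∣ ℚ.≤ (ℤ.+ D / 1) ℚ.* ℚ.∣ ℤ.+ 1 / d ∣
ratio-≤ s ℓ@(suc ℓ′) D d@(suc d′) sd≤Dℓ = subst₂ (λ p q → p ℚ.≤ (ℤ.+ D / 1) ℚ.* q) (sym (absolute s ℓ)) (sym (absolute 1 d))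
    (ℚ.toℚᵘ-cancel-≤ (ℚᵘ.≤-respˡ-≃ (ℚᵘ.≃-sym (ℚ.toℚᵘ-fromℚᵘ (ℚᵘ.mkℚᵘ (ℤ.+ s) ℓ′)))
      (ℚᵘ.≤-respʳ-≃ (ℚᵘ.≃-sym (ℚᵘ.≃-trans (ℚ.toℚᵘ-homo-* (ℤ.+ D / 1) (ℤ.+ 1 / d))
          (ℚᵘ.*-cong (ℚ.toℚᵘ-fromℚᵘ (ℚᵘ.mkℚᵘ (ℤ.+ D) 0)) (ℚ.toℚᵘ-fromℚᵘ (ℚᵘ.mkℚᵘ (ℤ.+ 1) d′)))))
        (ℚᵘ.*≤* (ℤ.≤-trans (ℤ.≤-reflexive (sym (ℤ.pos-* s (1 * d)))) (ℤ.≤-trans (ℤ.+≤+ cross)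
          (ℤ.≤-reflexive (trans (ℤ.pos-* (D * 1) ℓ) (cong (ℤ._* ℤ.+ ℓ) (ℤ.pos-* D 1))))))))))
  where
  absolute : ∀ a b .{{_ : NonZero b}} → ℚ.∣ ℤ.+ a / b ∣ ≡ ℤ.+ a / b
  absolute a b = ℚ.0≤p⇒∣p∣≡p (ℚ.nonNegative⁻¹ (ℤ.+ a / b) {{ℚ.normalize-nonNeg a b}})
  cross : s * (1 * d) ≤ D * 1 * ℓ
  cross = subst₂ (λ x y → s * x ≤ y * ℓ) (sym (ℕ.*-identityˡ d)) (sym (ℕ.*-identityʳ D)) sd≤Dℓ

expectation-≤ : ∀ {A : Set} (xs : List A) X D d .{{_ : NonZero d}} → sum (map X xs) * d ≤ D * length xs →
  ℚ.∣ expectation xs X ∣ ℚ.≤ (ℤ.+ D / 1) ℚ.* ℚ.∣ ℤ.+ 1 / d ∣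
-- The default value 0 of the expectation is treated as 0 / 1.
expectation-≤ [] X D d _ = ratio-≤ 0 1 D d z≤n
expectation-≤ xs@(_ ∷ _) X D d bound = ratio-≤ (sum (map X xs)) (length xs) D d bound

theorem1p1 : (m k : ℕ → ℕ) (n₀ : ℕ) →
    (∀ n → n₀ ≤ n → 4 ≤ m n × m n ≤ k n × 2 * m n ≤ n × k n ≤ n) →
    (λ n → 𝔼 (m n) (k n) n) =O (λ n → n ⁻²)
theorem1p1 m k n₀ hyp = ℤ.+ D / 1 , suc n₀ , λ where
    -- The threshold `suc n₀` excludes n = 0, where `_⁻²` has an arbitrary value.
    (suc n) (s≤s n₀≤n) → let (4≤m , _ , 2m≤n , k≤n) = hyp (suc n) (ℕ.m≤n⇒m≤1+n n₀≤n) in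
      expectation-≤ (latinRectangles (k (suc n)) (suc n)) (numSubsquares (m (suc n))) D (suc n ^ 2) {{ℕ.m^n≢0 (suc n) 2}}
        (subst (λ N → N * suc n ^ 2 ≤ D * length (latinRectangles (k (suc n)) (suc n)))
          -- `numSubsquares` is by definition the length of `subsquares`, so the size of `located`
          -- is the sum in the expectation.
          (length-pairs (latinRectangles (k (suc n)) (suc n)) (subsquares (m (suc n))))
          (proj₂ uniform-bound (m (suc n)) (k (suc n)) (suc n) 4≤m 2m≤n k≤n))
  where
  D = proj₁ uniform-bound
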